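{- Let $n\ge1$. The function $\psi_n:\mathrm{PF}_n\to\mathrm{PF}_n$ is the inverse of $\phi_n:\mathrm{PF}_n\to\mathrm{PF}_n$.
   Context: Let $n\geq 1$ and $[n]=\{1,\dots,n\}$. A parking function of size $n$ is a function $f:[n]\to[n]$ with $|f^{ -1}(\{1,\dots,m\})|\ge m$ for all $m\in[n]$; $\mathrm{PF}_n$ is the set of these. Labelled Dyck paths: a labelled $m$-Dyck path is a lattice path from $(0,0)$ to $(m,m)$ with north and east unit steps, never below the diagonal $y=x$, whose north steps are labelled by positive integers so that labels on the same vertical line increase from bottom to top. Throughout, labels are pairwise distinct. For such a path $P$ and a label $\lambda$ of $P$, let $P(\lambda)$ be the column of $\lambda$ (so $P(\lambda)=i$ if the north step labelled $\lambda$ is on the line $x=i-1$), and let $a_\lambda(P)$ be the number of whole unit squares between $P$ and $y=x$ in the row of $\lambda$ (if $\lambda$ is in the $r$-th row from the bottom, $a_\lambda(P)=r-P(\lambda)$). A pair of labels $\{\lambda,\mu\}$ with $\lambda<\mu$ is a diagonal inversion of $P$ if either (A) $P(\lambda)<P(\mu)$ and $a_\lambda(P)=a_\mu(P)$, or (B) $P(\lambda)>P(\mu)$ and $a_\lambda(P)+1=a_\mu(P)$. The set of diagonal inversions is $\mathrm{Dinv}(P)$. Parking functions of size $n$ are identified with labelled $n$-Dyck paths with label set $[n]$, $f$ corresponding to the path in which the labels on the line $x=i-1$ are those in $f^{ -1}(i)$. The map $\phi_n$: for $f\in\mathrm{PF}_n$, the dinv reading word of $f$ is the word $w_1w_2\cdots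 w_n$ listing all labels in increasing order with respect to the total order in which $\lambda$ precedes $\mu$ iff $a_\lambda(f)<a_\mu(f)$, or $a_\lambda(f)=a_\mu(f)$ and $f(\lambda)<f(\mu)$. For $\lambda=w_j$ set $d_\lambda(f)=\#\{\{w_i,w_j\}\in\mathrm{Dinv}(f) : i<j\}$. Then $\phi_n:\mathrm{PF}_n\to\mathrm{PF}_n$ is defined by $(\phi_n(f))(w_i)=i-d_{w_i}(f)$ for all $i\in[n]$ (this is indeed a parking function). The pmaj word: for $g\in\mathrm{PF}_n$ the permutation $\sigma_{\mathrm{pmaj}}(g)=\sigma_1\cdots\sigma_n$ (one-line notation) is defined as follows. Set $B_0'=\varnothing$, $\sigma_0=n+1$. For $m=1,\dots,n$: let $B_m=B_{m-1}'\cup g^{ -1}(m)$ and $X_m=\{a\in B_m: a<\sigma_{m-1}\}$; put $\sigma_m=\max X_m$ if $X_m\ne\varnothing$ and $\sigma_m=\max B_m$ otherwise; let $B_m'=B_m\setminus\{\sigma_m\}$. For a label $\lambda=\sigma_m$, let $p_\lambda(g)=\#\{i : 1\le i<m,\ \sigma_i<\sigma_{i+1}\}$ and $c_\lambda(g)=g(\lambda)-1$. The map $\psi_n$: for $g\in\mathrm{PF}_n$, start with the empty labelled $0$-Dyck path (the single point $(0,0)$) and perform Steps $m=1,\dots,n$. At Step $m$, given the labelled $(m-1)$-Dyck path $P_{m-1}$ obtained so far (with labels $\sigma_1,\dots,\sigma_{m-1}$), consider the lattice points of $P_{m-1}$ lying on the diagonal $y=x+p_{\sigma_m}(g)$. Inserting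 $\sigma_m$ at such a point means inserting there a north step labelled $\sigma_m$ immediately followed by an east step (the remainder of the path being translated by $(1,1)$). The point is suitable if the result is a labelled $m$-Dyck path. In the resulting path, $\sigma_m$ avoids a diagonal inversion with $\lambda\in\{\sigma_1,\dots,\sigma_{m-1}\}$ if $\{\lambda,\sigma_m\}$ is not a diagonal inversion of it. There is exactly one suitable point at which the insertion makes $\sigma_m$ avoid exactly $c_{\sigma_m}(g)$ diagonal inversions; insert $\sigma_m$ there to get $P_m$. Then $\psi_n(g)\in\mathrm{PF}_n$ is the parking function corresponding to $P_n$. -}

module Defs where

open import Data.Nat.Base using (ℕ; zero; suc; _+_; _∸_; _≤_; _<_; z≤n; s≤s)
import Data.Nat.Properties as ℕ
open import Data.Bool.Base using (if_then_else_)
open import Data.Fin.Base as Fin using (Fin; toℕ; fromℕ<)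
import Data.Fin.Properties as Fin
open import Data.List.Base
  using (List; []; _∷_; _++_; _∷ʳ_; [_]; length; map; concatMap; filter; take; drop; takeWhile; allFin)
open import Data.List.Properties using (length-tabulate)
open import Data.List.Extrema using (max)
open import Data.List.Membership.Propositional using (_∈_)
open import Data.List.Membership.Propositional.Properties using (∈-allFin)
open import Data.List.Relation.Unary.All as All using (All; []; _∷_)
open import Data.List.Relation.Unary.Any using (here; there)
open import Data.List.Relation.Unary.Unique.Propositional using (Unique)
open import Data.List.Relation.Binary.Permutation.Propositional using (_↭_; ↭-sym)
open import Data.List.Relation.Binary.Permutation.Propositional.Properties
  using (↭-length; filter-↭; ∈-resp-↭)
import Data.List.Sort.InsertionSort.Base as InsertionSort
import Data.List.Sort.InsertionSort.Properties as InsertionSort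
open import Data.Product using (_×_; _,_; proj₁; ∃!)
open import Data.Product.Relation.Binary.Lex.NonStrict using (×-decTotalOrder)
open import Data.Sum.Base using (_⊎_)
open import Data.Vec.Base using (Vec; lookup; tabulate)
open import Data.Vec.Properties using (lookup∘tabulate)
open import Function.Base using (_∘_)
open import Relation.Binary.Bundles using (DecTotalOrder)
import Relation.Binary.Construct.On as On
open import Relation.Binary.PropositionalEquality
  using (_≡_; refl; sym; trans; cong; subst)
open import Relation.Nullary.Decidable using (Dec; does; yes; no; ¬?; _×-dec_; _⊎-dec_)
open import Relation.Nullary.Negation using (contradiction)
open import Relation.Unary using (Decidable)

private variable
  n : ℕ

------------------------------------------------------------------------
-- Parking functions

-- Throughout, i : Fin n stands for the element suc (toℕ i) of {1, …, n}.

-- #[ P? ] is the number of elements of Fin n satisfying P.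
#[_] : {P : Fin n → Set} → Decidable P → ℕ
#[ P? ] = length (filter P? (allFin _))

Parking : (Fin n → Fin n) → Set
Parking {n} f = (m : Fin n) → suc (toℕ m) ≤ #[ (λ i → f i Fin.≤? m) ]

-- A function {1, …, n} → {1, …, n} is stored as its vector of values and the
-- parking condition is irrelevant, so _≡_ on PF n is equality of functions.
record PF (n : ℕ) : Set where
  constructor mkPF
  field
    values   : Vec (Fin n) n
    .parking : Parking (lookup values)

infix 30 _⟨_⟩

_⟨_⟩ : PF n → Fin n → Fin n
f ⟨ i ⟩ = lookup (PF.values f) i

------------------------------------------------------------------------
-- Labelled Dyck paths

-- Only paths labelled by elements of {1, …, n} occur.
data Step (n : ℕ) : Set where
  N : Fin n → Step n
  E : Step n

Path : ℕ → Set
Path n = List (Step n)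

labels : Path n → List (Fin n)
labels []        = []
labels (N ℓ ∷ P) = ℓ ∷ labels P
labels (E ∷ P)   = labels P

#N : Path n → ℕ
#N P = length (labels P)

#E : Path n → ℕ
#E []        = 0
#E (N _ ∷ P) = #E P
#E (E ∷ P)   = suc (#E P)

isNorth? : (ℓ : Fin n) → Decidable (_≡ N ℓ)
isNorth? ℓ E = no λ ()
isNorth? ℓ (N μ) with μ Fin.≟ ℓ
... | yes refl = yes refl
... | no  μ≢ℓ  = no λ { refl → μ≢ℓ refl }

-- The part of the path below the north step labelled ℓ.  It, and the
-- functions row, column and area, are only meaningful when ℓ labels the path.
below : Path n → Fin n → Path n
below P ℓ = takeWhile (¬? ∘ isNorth? ℓ) P

row : Path n → Fin n → ℕ
row P ℓ = suc (#N (below P ℓ))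

column : Path n → Fin n → ℕ
column P ℓ = suc (#E (below P ℓ))

area : Path n → Fin n → ℕ
area P ℓ = row P ℓ ∸ column P ℓ

record IsLabelledDyck (m : ℕ) (P : Path n) : Set where
  field
    norths     : #N P ≡ m
    easts      : #E P ≡ m
    above      : ∀ k → #E (take k P) ≤ #N (take k P)
    distinct   : Unique (labels P)
    increasing : ∀ {ℓ μ} → ℓ ∈ labels P → μ ∈ labels P →
                 column P ℓ ≡ column P μ → row P ℓ < row P μ → ℓ Fin.< μ

-- Diagonal inversions (ℓ , μ) with ℓ < μ.
OrderedDinv : Path n → Fin n → Fin n → Set
OrderedDinv P ℓ μ = ℓ Fin.< μ ×
  ( (column P ℓ < column P μ × area P ℓ ≡ area P μ)
  ⊎ (column P μ < column P ℓ × area P ℓ + 1 ≡ area P μ) )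

-- The unordered pair {ℓ , μ} is a diagonal inversion.
Dinv : Path n → Fin n → Fin n → Set
Dinv P ℓ μ = OrderedDinv P ℓ μ ⊎ OrderedDinv P μ ℓ

orderedDinv? : (P : Path n) (ℓ μ : Fin n) → Dec (OrderedDinv P ℓ μ)
orderedDinv? P ℓ μ = ℓ Fin.<? μ ×-dec
  ( (column P ℓ ℕ.<? column P μ ×-dec area P ℓ ℕ.≟ area P μ)
  ⊎-dec (column P μ ℕ.<? column P ℓ ×-dec area P ℓ + 1 ℕ.≟ area P μ) )

dinv? : (P : Path n) (ℓ μ : Fin n) → Dec (Dinv P ℓ μ)
dinv? P ℓ μ = orderedDinv? P ℓ μ ⊎-dec orderedDinv? P μ ℓ

-- The preimage of i, in increasing order.
fiber : PF n → Fin n → List (Fin n)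
fiber f i = filter (λ ℓ → f ⟨ ℓ ⟩ Fin.≟ i) (allFin _)

path : PF n → Path n
path f = concatMap (λ i → map N (fiber f i) ++ [ E ]) (allFin _)

------------------------------------------------------------------------
-- The map φ

module _ (f : PF n) where

  -- Lexicographic comparison of (area of ℓ , f(ℓ)).
  readingOrder : DecTotalOrder _ _ _
  readingOrder = On.decTotalOrder
    (×-decTotalOrder ℕ.≤-decTotalOrder (Fin.≤-decTotalOrder n))
    (λ (ℓ : Fin n) → area (path f) ℓ , f ⟨ ℓ ⟩)

  dinvWord : List (Fin n)
  dinvWord = InsertionSort.sort readingOrder (allFin n)

  dinvWord-↭ : dinvWord ↭ allFin n
  dinvWord-↭ = InsertionSort.sort-↭ readingOrder (allFin n)

-- The entries preceding the (first) occurrence of x.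
preceding : List (Fin n) → Fin n → List (Fin n)
preceding w x = takeWhile (λ y → ¬? (y Fin.≟ x)) w

d : PF n → Fin n → ℕ
d f ℓ = length (filter (λ μ → dinv? (path f) μ ℓ) (preceding (dinvWord f) ℓ))

-- If ℓ is the i-th letter of the word then its preceding letters number
-- i - 1, so this is the zero-based counterpart of i - d(ℓ).
φ-value : PF n → Fin n → ℕ
φ-value f ℓ = length (preceding (dinvWord f) ℓ) ∸ d f ℓ

preceding-< : (w : List (Fin n)) {x : Fin n} → x ∈ w →
              length (preceding w x) < length w
preceding-< (y ∷ w) {x} x∈ with y Fin.≟ x
preceding-< (y ∷ w) x∈          | yes _  = s≤s z≤n
preceding-< (y ∷ w) (here refl) | no y≢x = contradiction refl y≢x
preceding-< (y ∷ w) (there x∈)  | no _   = s≤s (preceding-< w x∈)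

preceding-take : (w : List (Fin n)) (k : ℕ) →
                 All (λ x → length (preceding w x) < k) (take k w)
preceding-take w       zero    = []
preceding-take []      (suc k) = []
preceding-take (y ∷ w) (suc k) = first ∷ All.map rest (preceding-take w k)
  where
  first : length (preceding (y ∷ w) y) < suc k
  first with y Fin.≟ y
  ... | yes _  = s≤s z≤n
  ... | no y≢y = contradiction refl y≢y

  rest : ∀ {x} → length (preceding w x) < k → length (preceding (y ∷ w) x) < suc k
  rest {x} lt with y Fin.≟ x
  ... | yes _ = s≤s z≤n
  ... | no  _ = s≤s lt

filter-take : {P : Fin n → Set} (P? : Decidable P) (k : ℕ) (w : List (Fin n)) →
              All P (take k w) → k ≤ length w → k ≤ length (filter P? w)
filter-take P? zero    w       _          _         = z≤n
filter-take P? (suc k) (x ∷ w) (px ∷ pxs) (s≤s k≤w) with P? x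
... | yes _  = s≤s (filter-take P? k w pxs k≤w)
... | no ¬px = contradiction px ¬px

length-allFin : ∀ n → length (allFin n) ≡ n
length-allFin n = length-tabulate (λ i → i)

length-dinvWord : (f : PF n) → length (dinvWord f) ≡ n
length-dinvWord {n} f = trans (↭-length (dinvWord-↭ f)) (length-allFin n)

φ-value-< : (f : PF n) (ℓ : Fin n) → φ-value f ℓ < n
φ-value-< {n} f ℓ = ℕ.≤-<-trans (ℕ.m∸n≤m _ (d f ℓ))
  (subst (length (preceding (dinvWord f) ℓ) <_) (length-dinvWord f)
    (preceding-< (dinvWord f) (∈-resp-↭ (↭-sym (dinvWord-↭ f)) (∈-allFin ℓ))))

φ-values : PF n → Vec (Fin n) n
φ-values f = tabulate (λ ℓ → fromℕ< (φ-value-< f ℓ))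

toℕ-φ-values : (f : PF n) (ℓ : Fin n) → toℕ (lookup (φ-values f) ℓ) ≡ φ-value f ℓ
toℕ-φ-values f ℓ = trans
  (cong toℕ (lookup∘tabulate (λ ℓ → fromℕ< (φ-value-< f ℓ)) ℓ))
  (Fin.toℕ-fromℕ< (φ-value-< f ℓ))

φ-parking : (f : PF n) → Parking (lookup (φ-values f))
φ-parking {n} f m = subst (suc (toℕ m) ≤_)
  (↭-length (filter-↭ P? (dinvWord-↭ f)))
  (filter-take P? (suc (toℕ m)) (dinvWord f)
    (All.map small (preceding-take (dinvWord f) (suc (toℕ m))))
    (subst (suc (toℕ m) ≤_) (sym (length-dinvWord f)) (Fin.toℕ<n m)))
  where
  P? = λ (ℓ : Fin n) → lookup (φ-values f) ℓ Fin.≤? m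

  small : ∀ {ℓ} → length (preceding (dinvWord f) ℓ) < suc (toℕ m) →
          lookup (φ-values f) ℓ Fin.≤ m
  small {ℓ} (s≤s le) = subst (_≤ toℕ m) (sym (toℕ-φ-values f ℓ))
    (ℕ.≤-trans (ℕ.m∸n≤m _ (d f ℓ)) le)

φ : PF n → PF n
φ f = mkPF (φ-values f) (φ-parking f)

------------------------------------------------------------------------
-- The pmaj word

-- The letter chosen from B when the previous letter has zero-based value s.
-- For parking functions B is never empty, so the default is never returned.
choose : (default : Fin n) (s : ℕ) (B : List (Fin n)) → Fin n
choose {n} default s B with filter (λ b → toℕ b ℕ.<? s) B | B
... | x ∷ X | _      = max (Fin.≤-totalOrder n) x X
... | []    | b ∷ bs = max (Fin.≤-totalOrder n) b bs
... | []    | []     = default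

-- The letters for the remaining values ms of m, given the previous letter s
-- and the set B′ left over from the previous round.
pmajFrom : PF n → (s : ℕ) (B′ : List (Fin n)) (ms : List (Fin n)) → List (Fin n)
pmajFrom g s B′ []       = []
pmajFrom g s B′ (m ∷ ms) = σ ∷ pmajFrom g (toℕ σ) (filter (λ b → ¬? (b Fin.≟ σ)) B) ms
  where
  B = B′ ++ fiber g m
  σ = choose m s B

-- The initial value σ₀ = n + 1 is n when labels are counted from zero.
pmajWord : PF n → List (Fin n)
pmajWord {n} g = pmajFrom g n [] (allFin n)

ascents : List (Fin n) → ℕ
ascents []          = 0
ascents (_ ∷ [])    = 0
ascents (x ∷ y ∷ w) = (if does (x Fin.<? y) then 1 else 0) + ascents (y ∷ w)

------------------------------------------------------------------------
-- The map ψ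

-- Lattice points of P are represented by the number k ≤ length P of steps of P
-- leading to them.
insert : Path n → ℕ → Fin n → Path n
insert P k ℓ = take k P ++ N ℓ ∷ E ∷ drop k P

avoided : Path n → List (Fin n) → Fin n → ℕ
avoided Q σs ℓ = length (filter (λ μ → ¬? (dinv? Q μ ℓ)) σs)

-- Here σs is the part of the pmaj word of g preceding ℓ, and P is the path
-- built from it.
record InsertionPoint (g : PF n) (σs : List (Fin n)) (P : Path n) (ℓ : Fin n)
                      (k : ℕ) : Set where
  field
    onPath     : k ≤ length P
    onDiagonal : #N (take k P) ≡ #E (take k P) + ascents (σs ∷ʳ ℓ)
    suitable   : IsLabelledDyck (suc (length σs)) (insert P k ℓ)
    -- zero-based, g(ℓ) - 1 is toℕ (g ⟨ ℓ ⟩)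
    avoids     : avoided (insert P k ℓ) σs ℓ ≡ toℕ (g ⟨ ℓ ⟩)

-- Builds g σs P: inserting the letters of σs in turn, each at its unique
-- insertion point, yields P.
data Builds (g : PF n) : List (Fin n) → Path n → Set where
  start  : Builds g [] []
  extend : ∀ {σs P ℓ} → Builds g σs P →
           (point : ∃! _≡_ (InsertionPoint g σs P ℓ)) →
           Builds g (σs ∷ʳ ℓ) (insert P (proj₁ point) ℓ)

-- A function ψ carrying out the insertion procedure; there is at most one.
IsPsi : (PF n → PF n) → Set
IsPsi ψ = ∀ g → Builds g (pmajWord g) (path (ψ g))

{-# OPTIONS --safe #-}

-- List the north steps of the path of f from left to right as letters (a , ℓ)
-- of area a and label ℓ, and order the letters by increasing area and, within
-- one area, by decreasing label.  Writing x⁺ for x raised by one area, a word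
-- comes from a labelled Dyck path iff it starts at area 0 and every letter y
-- following a letter x satisfies y < x⁺.  In these terms the value of φ f at
-- the letter x counts the letters z to the left of x with z < x and those to
-- the right of x with z⁺ < x.
--
-- Consequently the pmaj word of φ f lists the letters in increasing order.
-- Its last letter is a peak N E of the path, and removing that peak changes
-- no value of φ at the other letters.  Going back, the letters of the pmaj
-- word are inserted one after the other; the insertion point is unique because
-- moving it to the right increases the number of avoided inversions.  Hence
-- the insertion procedure for φ f ends in the path of f, so φ is injective, and
-- being an endomap of a finite set it is bijective; ψ is its inverse.

module Submission where

open import Defs
open import Data.Bool.Base using (if_then_else_)
open import Data.Nat.Base using (ℕ; zero; suc; _+_; _*_; _∸_; _^_; _≤_; _<_; z≤n; s≤s; s≤s⁻¹)
open import Data.Nat.GeneralisedArithmetic using (fold)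
import Data.Nat.Properties as ℕ
open import Data.Fin.Base as Fin using (Fin; zero; suc; toℕ)
import Data.Fin.Properties as Fin
open import Data.List.Base
  using (List; []; _∷_; _++_; _∷ʳ_; [_]; length; map; concatMap; filter; take; drop;
         tabulate; allFin; InitLast; _∷ʳ′_; initLast)
open import Data.List.Extrema using (max; v≤max⁺; max≤v⁺)
open import Data.List.Properties
  using (filter-++; filter-all; length-filter; length-++; length-++-≤ˡ; length-map; map-++;
         ++-assoc; ++-identityʳ; ∷-injective; ∷ʳ-injective; take++drop≡id)
open import Data.List.Membership.Propositional using (_∈_; _∉_)
open import Data.List.Membership.Propositional.Properties
  using (∈-++⁺ˡ; ∈-++⁺ʳ; ∈-++⁻; ∈-map⁺; ∈-map⁻; ∈-filter⁺; ∈-filter⁻; ∈-allFin)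
open import Data.List.Relation.Unary.All as All using (All; []; _∷_)
import Data.List.Relation.Unary.All.Properties as All
open import Data.List.Relation.Unary.AllPairs as AllPairs using (AllPairs; []; _∷_)
import Data.List.Relation.Unary.AllPairs.Properties as AllPairs
open import Data.List.Relation.Unary.Any as Any using (here; there)
import Data.List.Relation.Unary.Linked.Properties as Linked
open import Data.List.Relation.Unary.Unique.Propositional using (Unique)
import Data.List.Relation.Unary.Unique.Propositional.Properties as Unique
open import Data.List.Relation.Binary.Permutation.Propositional
  using (_↭_; ↭-refl; ↭-sym; ↭-trans; ↭-reflexive; ↭⇒↭ₛ; prep; module PermutationReasoning)
open import Data.List.Relation.Binary.Permutation.Propositional.Properties
  using (↭-length; filter-↭; drop-mid; ∈-resp-↭; map⁺; shift; ++⁺ʳ)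
import Data.List.Relation.Binary.Permutation.Setoid.Properties as Permutationₛ
import Data.List.Sort.InsertionSort.Base as InsertionSort
import Data.List.Sort.InsertionSort.Properties as InsertionSort
open import Data.Product.Base using (Σ-syntax; _×_; _,_; proj₁; proj₂; ∃; ∃₂; map₂)
open import Data.Sum.Base using (_⊎_; inj₁; inj₂)
open import Data.Vec.Properties using (tabulate∘lookup; tabulate-cong)
open import Function.Base using (_∘_; id)
open import Function.Definitions using (Injective; Inverseᵇ)
open import Relation.Binary.Bundles using (DecTotalOrder)
import Relation.Binary.Construct.On as On
open import Relation.Binary.Definitions using (tri<; tri≈; tri>)
open import Relation.Binary.PropositionalEquality
  using (_≡_; _≢_; refl; sym; trans; cong; cong₂; subst; subst₂; setoid; module ≡-Reasoning)
open import Relation.Nullary.Decidable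
  using (Dec; does; yes; no; ¬?; _×-dec_; _⊎-dec_; dec-true; dec-false; recompute)
open import Relation.Nullary.Negation using (¬_; contradiction)
open import Relation.Unary using (Decidable)

-- The pmaj rule reads labels cyclically, and keys explain why. Let the previous letter have key k,
-- area a and label s. In the window of keys above k and up to k + n come first the labels below s,
-- in area a, from the largest down, and then the labels from s on, in area a + 1, again from the
-- largest down. Hence, if all of B lies in the window, the rule picks the least key of B. That B
-- lies there follows from two estimates for the zero-based value v of φ f at a letter x. As v is at
-- most the number of letters lower than x, x has entered B when its turn comes. If x has positive
-- area, v exceeds the number of letters z with z⁺ < x, so x does not enter B while it is above the
-- window. This strictness comes from a letter to the left of x that is lower than x by less than n.
-- That every g admits the insertion procedure is not shown by locating the points from g:
-- surjectivity of φ supplies an f with φ f = g, and the path of f shows where each letter goes.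

private variable
  n : ℕ
  X Y : Set

-- Lists

length-∷ʳ : (xs : List X) (x : X) → length (xs ∷ʳ x) ≡ suc (length xs)
length-∷ʳ xs _ = trans (length-++ xs) (ℕ.+-comm (length xs) 1)

∷ʳ≢[] : (xs : List X) {x : X} → xs ∷ʳ x ≢ []
∷ʳ≢[] []      ()
∷ʳ≢[] (_ ∷ _) ()

++-≡-split : ∀ (xs : List X) {ys zs y ws} → xs ++ ys ≡ zs ++ y ∷ ws →
             (∃ λ ms → xs ≡ zs ++ y ∷ ms × ws ≡ ms ++ ys) ⊎
             (∃ λ ms → zs ≡ xs ++ ms × ys ≡ ms ++ y ∷ ws)
++-≡-split []       {zs = zs}     eq   = inj₂ (zs , refl , eq)
++-≡-split (x ∷ xs) {zs = []}     refl = inj₁ (xs , refl , refl)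
++-≡-split (x ∷ xs) {zs = z ∷ zs} eq with ∷-injective eq
... | refl , eq′ with ++-≡-split xs eq′
...   | inj₁ (ms , refl , refl) = inj₁ (ms , refl , refl)
...   | inj₂ (ms , refl , refl) = inj₂ (ms , refl , refl)

take-length-++ : ∀ (xs : List X) {ys} → take (length xs) (xs ++ ys) ≡ xs
take-length-++ []       = refl
take-length-++ (x ∷ xs) = cong (x ∷_) (take-length-++ xs)

drop-length-++ : ∀ (xs : List X) {ys} → drop (length xs) (xs ++ ys) ≡ ys
drop-length-++ []       = refl
drop-length-++ (x ∷ xs) = drop-length-++ xs

take-drop-split : ∀ {j k} (xs : List X) → j < k → k ≤ length xs →
  ∃ λ ys → drop j xs ≡ ys ++ drop k xs × take k xs ≡ take j xs ++ ys × ys ≢ []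
take-drop-split {j = zero} {suc k} xs@(x ∷ _) _ _ =
  take (suc k) xs , sym (take++drop≡id (suc k) xs) , refl , λ ()
take-drop-split {j = suc j} {suc k} (x ∷ xs) (s≤s j<k) (s≤s k≤) with take-drop-split xs j<k k≤
... | ys , eq₁ , eq₂ , ys≢[] = ys , eq₁ , cong (x ∷_) eq₂ , ys≢[]

AllPairs-++⁻ : ∀ {R : X → X → Set} xs {ys} → AllPairs R (xs ++ ys) →
               AllPairs R xs × AllPairs R ys × All (λ x → All (R x) ys) xs
AllPairs-++⁻ []       rs       = [] , rs , []
AllPairs-++⁻ (x ∷ xs) (r ∷ rs) with AllPairs-++⁻ xs rs | All.++⁻ xs r
... | ps , qs , c | r₁ , r₂ = r₁ ∷ ps , qs , r₂ ∷ c

filter-↭-++ : {P Q R : X → Set} (P? : Decidable P) (Q? : Decidable Q) (R? : Decidable R) →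
              (∀ {x} → P x → R x) → (∀ {x} → Q x → R x) → (∀ {x} → R x → P x ⊎ Q x) →
              (∀ {x} → P x → ¬ Q x) → ∀ xs → filter R? xs ↭ filter P? xs ++ filter Q? xs
filter-↭-++ P? Q? R? P⇒R Q⇒R R⇒ disjoint [] = ↭-refl
filter-↭-++ P? Q? R? P⇒R Q⇒R R⇒ disjoint (x ∷ xs)
  with P? x | Q? x | R? x | filter-↭-++ P? Q? R? P⇒R Q⇒R R⇒ disjoint xs
... | yes p | yes q | _     | _  = contradiction q (disjoint p)
... | yes _ | no  _ | yes _ | ih = prep x ih
... | no  _ | yes _ | yes _ | ih = ↭-trans (prep x ih) (↭-sym (shift x (filter P? xs) _))
... | no  _ | no  _ | no  _ | ih = ih
... | yes p | _     | no ¬r | _  = contradiction (P⇒R p) ¬r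
... | no  _ | yes q | no ¬r | _  = contradiction (Q⇒R q) ¬r
... | no ¬p | no ¬q | yes r | _  with R⇒ r
...   | inj₁ p = contradiction p ¬p
...   | inj₂ q = contradiction q ¬q

count : {P : X → Set} → Decidable P → List X → ℕ
count P? = length ∘ filter P?

count-++ : {P : X → Set} (P? : Decidable P) (xs ys : List X) →
           count P? (xs ++ ys) ≡ count P? xs + count P? ys
count-++ P? xs ys = trans (cong length (filter-++ P? xs ys)) (length-++ (filter P? xs))

count-↭ : {P : X → Set} (P? : Decidable P) {xs ys : List X} → xs ↭ ys → count P? xs ≡ count P? ys
count-↭ P? p = ↭-length (filter-↭ P? p)

count-map : {P : Y → Set} (f : X → Y) (P? : Decidable P) (xs : List X) →
            count P? (map f xs) ≡ count (P? ∘ f) xs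
count-map f P? []       = refl
count-map f P? (x ∷ xs) with P? (f x)
... | yes _ = cong suc (count-map f P? xs)
... | no  _ = count-map f P? xs

count-mono : {P Q : X → Set} (P? : Decidable P) (Q? : Decidable Q) (xs : List X) →
             (∀ {x} → x ∈ xs → P x → Q x) → count P? xs ≤ count Q? xs
count-mono P? Q? []       _   = z≤n
count-mono P? Q? (x ∷ xs) imp with P? x | Q? x
... | yes _  | yes _  = s≤s (count-mono P? Q? xs (imp ∘ there))
... | yes px | no ¬qx = contradiction (imp (here refl) px) ¬qx
... | no  _  | yes _  = ℕ.m≤n⇒m≤1+n (count-mono P? Q? xs (imp ∘ there))
... | no  _  | no  _  = count-mono P? Q? xs (imp ∘ there)

count-cong : {P Q : X → Set} (P? : Decidable P) (Q? : Decidable Q) (xs : List X) →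
             (∀ {x} → x ∈ xs → P x → Q x) → (∀ {x} → x ∈ xs → Q x → P x) →
             count P? xs ≡ count Q? xs
count-cong P? Q? xs to from =
  ℕ.≤-antisym (count-mono P? Q? xs to) (count-mono Q? P? xs from)

count-strict : {P Q : X → Set} (P? : Decidable P) (Q? : Decidable Q) (xs : List X) →
               (∀ {x} → x ∈ xs → P x → Q x) →
               ∀ {y} → y ∈ xs → ¬ P y → Q y → count P? xs < count Q? xs
count-strict P? Q? (x ∷ xs) imp y∈ ¬py qy with P? x | Q? x | y∈
... | yes px | _      | here refl = contradiction px ¬py
... | _      | no ¬qx | here refl = contradiction qy ¬qx
... | no _   | yes _  | here refl = s≤s (count-mono P? Q? xs (imp ∘ there))
... | yes _  | yes _  | there y∈′ = s≤s (count-strict P? Q? xs (imp ∘ there) y∈′ ¬py qy)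
... | yes px | no ¬qx | there _   = contradiction (imp (here refl) px) ¬qx
... | no _   | yes _  | there y∈′ = ℕ.m≤n⇒m≤1+n (count-strict P? Q? xs (imp ∘ there) y∈′ ¬py qy)
... | no _   | no _   | there y∈′ = count-strict P? Q? xs (imp ∘ there) y∈′ ¬py qy

count-all : {P : X → Set} (P? : Decidable P) (xs : List X) → (∀ {x} → x ∈ xs → P x) →
            count P? xs ≡ length xs
count-all P? []       _   = refl
count-all P? (x ∷ xs) all with P? x
... | yes _  = cong suc (count-all P? xs (all ∘ there))
... | no ¬px = contradiction (all (here refl)) ¬px

count-none : {P : X → Set} (P? : Decidable P) (xs : List X) → (∀ {x} → x ∈ xs → ¬ P x) →
             count P? xs ≡ 0
count-none P? []       _    = refl
count-none P? (x ∷ xs) none with P? x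
... | yes px = contradiction px (none (here refl))
... | no  _  = count-none P? xs (none ∘ there)

length-∸-count : {P : X → Set} (P? : Decidable P) (xs : List X) →
                 length xs ∸ count P? xs ≡ count (¬? ∘ P?) xs
length-∸-count P? []       = refl
length-∸-count P? (x ∷ xs) with P? x
... | yes _ = length-∸-count P? xs
... | no  _ = trans (ℕ.+-∸-assoc 1 (length-filter P? xs)) (cong suc (length-∸-count P? xs))

count-skip : ∀ {P : X → Set} (P? : Decidable P) xs {x ys} → ¬ P x →
             count P? (xs ++ x ∷ ys) ≡ count P? (xs ++ ys)
count-skip P? []       {x} ¬px with P? x
... | yes px = contradiction px ¬px
... | no  _  = refl
count-skip P? (y ∷ xs) ¬px with P? y
... | yes _ = cong suc (count-skip P? xs ¬px)
... | no  _ = count-skip P? xs ¬px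

count-full : ∀ {P : X → Set} (P? : Decidable P) xs → count P? xs ≡ length xs → ∀ {x} → x ∈ xs → P x
count-full P? (x ∷ xs) eq x∈ with P? x
count-full P? (x ∷ xs) eq (here refl) | yes px = px
count-full P? (x ∷ xs) eq (there x∈)  | yes _  = count-full P? xs (ℕ.suc-injective eq) x∈
count-full P? (x ∷ xs) eq x∈          | no  _  =
  contradiction (length-filter P? xs) (ℕ.<⇒≱ (ℕ.≤-reflexive (sym eq)))

-- Keys

-- Keys linearise the order by increasing area and, within one area, by
-- decreasing label.  Raising the area by one adds n to the key.
key : (n a s : ℕ) → ℕ
key n a s = a * n + (n ∸ s)

-- `key` itself takes plain numbers as labels because the pmaj word starts from the fictitious
-- previous letter n, which lies outside `Fin n`. In area 0 that letter has key 0, below every `κ`.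
κ : ℕ × Fin n → ℕ
κ {n} (a , ℓ) = key n a (toℕ ℓ)

key-suc : ∀ n a s → n + key n a s ≡ key n (suc a) s
key-suc n a s = sym (ℕ.+-assoc n (a * n) (n ∸ s))

key-area-≤ : ∀ {n a b} s t → a < b → key n a s ≤ key n b t
key-area-≤ {n} {a} {b} s t a<b = begin
  a * n + (n ∸ s)  ≤⟨ ℕ.+-monoʳ-≤ (a * n) (ℕ.m∸n≤m n s) ⟩
  a * n + n        ≡⟨ ℕ.+-comm (a * n) n ⟩
  suc a * n        ≤⟨ ℕ.*-monoˡ-≤ n a<b ⟩
  b * n            ≤⟨ ℕ.m≤m+n (b * n) (n ∸ t) ⟩
  b * n + (n ∸ t)  ∎
  where open ℕ.≤-Reasoning

key-label : ∀ {n} a {s t} → t < s → s ≤ n → key n a s < key n a t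
key-label {n} a t<s s≤n = ℕ.+-monoʳ-< (a * n) (ℕ.∸-monoʳ-< t<s s≤n)

key-area : ∀ {n a b} s {t} → a < b → t < n → key n a s < key n b t
key-area {n} {a} {b} s a<b t<n =
  ℕ.≤-<-trans (key-area-≤ s n a<b) (key-label b t<n ℕ.≤-refl)

key-<⁻ : ∀ {n a b s t} → s < n → key n a s < key n b t → a < b ⊎ (a ≡ b × t < s)
key-<⁻ {n} {a} {b} {s} {t} s<n lt with ℕ.<-cmp a b
... | tri< a<b _ _ = inj₁ a<b
... | tri> _ _ b<a = contradiction lt (ℕ.<⇒≯ (key-area t b<a s<n))
... | tri≈ _ refl _ with s ℕ.≤? t
...   | yes s≤t = contradiction lt (ℕ.≤⇒≯ (ℕ.+-monoʳ-≤ (a * n) (ℕ.∸-monoʳ-≤ n s≤t)))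
...   | no  s≰t = inj₂ (refl , ℕ.≰⇒> s≰t)

key-≤⁻ : ∀ {n a b s t} → s < n → t ≤ n → key n a s ≤ key n b t → a < b ⊎ (a ≡ b × t ≤ s)
key-≤⁻ {n} {a} {b} {s} {t} s<n t≤n le with ℕ.<-cmp a b
... | tri< a<b _ _ = inj₁ a<b
... | tri> _ _ b<a = contradiction le (ℕ.<⇒≱ (key-area t b<a s<n))
... | tri≈ _ refl _ with t ℕ.≤? s
...   | yes t≤s = inj₂ (refl , t≤s)
...   | no  t≰s = contradiction le (ℕ.<⇒≱ (key-label a (ℕ.≰⇒> t≰s) t≤n))

κ-area : ∀ (x y : ℕ × Fin n) → proj₁ x < proj₁ y → κ x < κ y
κ-area (_ , μ) (_ , ν) a<b = key-area (toℕ μ) a<b (Fin.toℕ<n ν)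

κ-label : ∀ a {μ ν : Fin n} → ν Fin.< μ → κ (a , μ) < κ (a , ν)
κ-label a {μ} ν<μ = key-label a ν<μ (ℕ.<⇒≤ (Fin.toℕ<n μ))

κ-<⁻ : ∀ {x y : ℕ × Fin n} → κ x < κ y →
       proj₁ x < proj₁ y ⊎ (proj₁ x ≡ proj₁ y × proj₂ y Fin.< proj₂ x)
κ-<⁻ {x = _ , μ} = key-<⁻ (Fin.toℕ<n μ)

κ-injective : ∀ {x y : ℕ × Fin n} → κ x ≡ κ y → x ≡ y
κ-injective {x = a , μ} {b , ν} eq
  with key-≤⁻ {b = b} (Fin.toℕ<n μ) (ℕ.<⇒≤ (Fin.toℕ<n ν)) (ℕ.≤-reflexive eq)
     | key-≤⁻ {b = a} (Fin.toℕ<n ν) (ℕ.<⇒≤ (Fin.toℕ<n μ)) (ℕ.≤-reflexive (sym eq))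
... | inj₁ a<b          | inj₁ b<a          = contradiction b<a (ℕ.<⇒≯ a<b)
... | inj₁ a<b          | inj₂ (refl , _)   = contradiction a<b (ℕ.n≮n _)
... | inj₂ (refl , _)   | inj₁ b<a          = contradiction b<a (ℕ.n≮n _)
... | inj₂ (refl , ν≤μ) | inj₂ (_ , μ≤ν)    = cong (a ,_) (Fin.toℕ-injective (ℕ.≤-antisym μ≤ν ν≤μ))

-- The pmaj word

max-unique : ∀ {ℓ x : Fin n} {X} → ℓ ∈ x ∷ X → All (Fin._≤ ℓ) (x ∷ X) →
             max (Fin.≤-totalOrder n) x X ≡ ℓ
max-unique {n} {ℓ} {x} {X} ℓ∈ (x≤ℓ ∷ X≤ℓ) = Fin.≤-antisym
  (max≤v⁺ (Fin.≤-totalOrder n) x≤ℓ X≤ℓ)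
  (v≤max⁺ (Fin.≤-totalOrder n) x X (split ℓ∈))
  where
  split : ℓ ∈ x ∷ X → ℓ Fin.≤ x ⊎ Any.Any (ℓ Fin.≤_) X
  split (here refl) = inj₁ Fin.≤-refl
  split (there ℓ∈X) = inj₂ (Any.map Fin.≤-reflexive ℓ∈X)

choose-small : ∀ (d : Fin n) s {B ℓ} → ℓ ∈ B → toℕ ℓ < s →
               (∀ {b} → b ∈ B → toℕ b < s → b Fin.≤ ℓ) → choose d s B ≡ ℓ
choose-small d s {B@(_ ∷ _)} {ℓ} ℓ∈B ℓ<s ≤ℓ
  with filter (λ b → toℕ b ℕ.<? s) B in eq
... | []    with () ← subst (ℓ ∈_) eq (∈-filter⁺ (λ b → toℕ b ℕ.<? s) ℓ∈B ℓ<s)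
... | _ ∷ _ = max-unique
  (subst (ℓ ∈_) eq (∈-filter⁺ (λ b → toℕ b ℕ.<? s) ℓ∈B ℓ<s))
  (All.tabulate λ b∈ →
    let b∈B , b<s = ∈-filter⁻ (λ b → toℕ b ℕ.<? s) (subst (_ ∈_) (sym eq) b∈)
    in ≤ℓ b∈B b<s)

choose-large : ∀ (d : Fin n) s {B ℓ} → ℓ ∈ B → (∀ {b} → b ∈ B → s ≤ toℕ b) →
               (∀ {b} → b ∈ B → b Fin.≤ ℓ) → choose d s B ≡ ℓ
choose-large d s {B@(_ ∷ _)} {ℓ} ℓ∈B s≤ ≤ℓ
  with filter (λ b → toℕ b ℕ.<? s) B in eq
... | []    = max-unique ℓ∈B (All.tabulate ≤ℓ)
... | x ∷ X = contradiction (proj₂ x∈) (ℕ.≤⇒≯ (s≤ (proj₁ x∈)))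
  where x∈ = ∈-filter⁻ (λ b → toℕ b ℕ.<? s) {xs = B} (subst (x ∈_) (sym eq) (here refl))

-- The upper end `n + key n a s` of the window is the key of the label s in area a + 1.
window-area : ∀ {n a s c t} → s ≤ n → t < n → key n c t ≤ n + key n a s →
              c ≤ a ⊎ (c ≡ suc a × s ≤ t)
window-area {n} {a} {s} {c} {t} s≤n t<n le with c ℕ.≤? a
... | yes c≤a = inj₁ c≤a
... | no  c≰a with ℕ.m≤n⇒m<n∨m≡n (ℕ.≰⇒> c≰a)
...   | inj₁ sa<c = contradiction le (ℕ.<⇒≱
          (subst (_< key n c t) (sym (key-suc n a s)) (key-area s sa<c t<n)))
...   | inj₂ refl with s ℕ.≤? t
...     | yes s≤t = inj₂ (refl , s≤t)
...     | no  s≰t = contradiction le (ℕ.<⇒≱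
            (subst (_< key n c t) (sym (key-suc n a s)) (key-label c (ℕ.≰⇒> s≰t) s≤n)))

-- The pmaj rule picks the element of least key in the window of width n above
-- the key (a , s) of the previous letter.
choose-least : ∀ (d : Fin n) a s {B x} → s ≤ n → proj₂ x ∈ B → key n a s < κ x →
               (∀ {b} → b ∈ B → Σ[ c ∈ ℕ ] (κ x ≤ κ (c , b) × κ (c , b) ≤ n + key n a s)) →
               choose d s B ≡ proj₂ x
choose-least {n} d a s {B} {a′ , ℓ} s≤n ℓ∈B lt window with toℕ ℓ ℕ.<? s
... | yes ℓ<s = choose-small d s ℓ∈B ℓ<s bounded
  where
  bounded : ∀ {b} → b ∈ B → toℕ b < s → b Fin.≤ ℓ
  bounded {b} b∈ b<s with window b∈
  ... | c , x≤z , z≤ with key-≤⁻ {a = a′} {b = c} (Fin.toℕ<n ℓ) (ℕ.<⇒≤ (Fin.toℕ<n b)) x≤z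
                        | window-area {a = a} {c = c} s≤n (Fin.toℕ<n b) z≤
  ...   | _              | inj₂ (_ , s≤b) = contradiction b<s (ℕ.≤⇒≯ s≤b)
  ...   | inj₂ (_ , b≤ℓ) | inj₁ _         = b≤ℓ
  ...   | inj₁ a′<c      | inj₁ c≤a       =
          contradiction lt (ℕ.≤⇒≯ (key-area-≤ (toℕ ℓ) s (ℕ.<-≤-trans a′<c c≤a)))
-- Here x lies in area a + 1. Then all of B lies in that area with labels at least s, so no letter
-- is smaller than the previous one.
... | no  ℓ≮s = choose-large d s ℓ∈B (proj₁ ∘ bounds) (proj₂ ∘ bounds)
  where
  a<a′ : a < a′
  a<a′ with ℕ.<-cmp a a′
  ... | tri< a<a′ _ _ = a<a′
  ... | tri≈ _ refl _ = contradiction lt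
    (ℕ.≤⇒≯ (ℕ.+-monoʳ-≤ (a * n) (ℕ.∸-monoʳ-≤ n (ℕ.≮⇒≥ ℓ≮s))))
  ... | tri> _ _ a′<a = contradiction lt (ℕ.≤⇒≯ (key-area-≤ (toℕ ℓ) s a′<a))

  bounds : ∀ {b} → b ∈ B → s ≤ toℕ b × b Fin.≤ ℓ
  bounds {b} b∈ with window b∈
  ... | c , x≤z , z≤ with key-≤⁻ {a = a′} {b = c} (Fin.toℕ<n ℓ) (ℕ.<⇒≤ (Fin.toℕ<n b)) x≤z
                        | window-area {a = a} {c = c} s≤n (Fin.toℕ<n b) z≤
  ...   | inj₁ a′<c         | inj₁ c≤a          =
          contradiction (ℕ.<-≤-trans a′<c c≤a) (ℕ.<⇒≯ a<a′)
  ...   | inj₂ (refl , _)   | inj₁ c≤a          = contradiction a<a′ (ℕ.≤⇒≯ c≤a)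
  ...   | inj₁ a′<c         | inj₂ (refl , _)   = contradiction a<a′ (ℕ.≤⇒≯ (s≤s⁻¹ a′<c))
  ...   | inj₂ (_ , b≤ℓ)    | inj₂ (_ , s≤b)    = s≤b , b≤ℓ

lower? : (x : ℕ × Fin n) → Decidable (λ (z : ℕ × Fin n) → κ z < κ x)
lower? x z = κ z ℕ.<? κ x

-- Lower by more than one full area.
farLower? : (x : ℕ × Fin n) → Decidable (λ (z : ℕ × Fin n) → n + κ z < κ x)
farLower? {n} x z = n + κ z ℕ.<? κ x

module _ (g : PF n) (S : List (ℕ × Fin n))
         (sorted : AllPairs (λ z x → κ z < κ x) S)
         (unique : Unique (map proj₂ S))
         (complete : ∀ b → b ∈ map proj₂ S)
         (atMost : ∀ {x} → x ∈ S → toℕ (g ⟨ proj₂ x ⟩) ≤ count (lower? x) S)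
         (atLeast : ∀ {x} → x ∈ S → 1 ≤ proj₁ x →
                    count (farLower? x) S < toℕ (g ⟨ proj₂ x ⟩))
  where

  private
    Available : List (ℕ × Fin n) → ℕ → Fin n → Set
    Available T m b = b ∉ map proj₂ T × toℕ (g ⟨ b ⟩) < m

  -- Induction over the rounds: T has been chosen, R remains, and (a , s) bounds the keys of T from
  -- above and those of R from below. `B′` holds exactly the labels outside T whose value is less
  -- than the number of rounds played. `atMost` puts the next letter into B, and `atLeast` keeps out
  -- of B every letter above the window, since all of T would be far lower than it.
  pmajFrom-sorted : ∀ T R {a s B′ k} (e : Fin k → Fin n) → S ≡ T ++ R →
    k ≡ length R → (∀ i → toℕ (e i) ≡ length T + toℕ i) → s ≤ n →
    All (λ u → κ u ≤ key n a s) T → All (λ x → key n a s < κ x) R →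
    All (λ u → toℕ (g ⟨ proj₂ u ⟩) < length T) T →
    (∀ {b} → b ∈ B′ → Available T (length T) b) →
    (∀ {b} → Available T (length T) b → b ∈ B′) →
    pmajFrom g s B′ (tabulate e) ≡ map proj₂ R
  pmajFrom-sorted T [] e _ refl _ _ _ _ _ _ _ = refl
  pmajFrom-sorted T (x ∷ R) {a} {s} {B′} e S≡ refl e≡ s≤n T≤ (<x ∷ <R) gT< sound compl =
    cons (choose-least (e zero) a s {x = x} s≤n (new-complete (ℓ∉T , s≤s gℓ≤)) <x window)
    where
    ℓ = proj₂ x
    Bₘ = B′ ++ fiber g (e zero)

    toℕ-e₀ : toℕ (e zero) ≡ length T
    toℕ-e₀ = trans (e≡ zero) (ℕ.+-identityʳ _)

    new-sound : ∀ {b} → b ∈ Bₘ → Available T (suc (length T)) b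
    new-sound {b} b∈ with ∈-++⁻ B′ b∈
    ... | inj₁ b∈B′ = let b∉T , gb< = sound b∈B′ in b∉T , ℕ.m<n⇒m<1+n gb<
    ... | inj₂ b∈f  = ∉T , s≤s (ℕ.≤-reflexive gb≡)
      where
      gb≡ : toℕ (g ⟨ b ⟩) ≡ length T
      gb≡ = trans (cong toℕ (proj₂ (∈-filter⁻ (λ b → g ⟨ b ⟩ Fin.≟ e zero) {xs = allFin n} b∈f))) toℕ-e₀
      ∉T : b ∉ map proj₂ T
      ∉T b∈T with ∈-map⁻ proj₂ b∈T
      ... | z , z∈T , refl = ℕ.<-irrefl gb≡ (All.lookup gT< z∈T)

    new-complete : ∀ {b} → Available T (suc (length T)) b → b ∈ Bₘ
    new-complete {b} (b∉T , s≤s gb≤) with ℕ.m≤n⇒m<n∨m≡n gb≤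
    ... | inj₁ gb< = ∈-++⁺ˡ (compl (b∉T , gb<))
    ... | inj₂ gb≡ = ∈-++⁺ʳ B′ (∈-filter⁺ (λ b → g ⟨ b ⟩ Fin.≟ e zero) (∈-allFin b)
                       (Fin.toℕ-injective (trans gb≡ (sym toℕ-e₀))))

    sorted-split = AllPairs-++⁻ T (subst (AllPairs _) S≡ sorted)

    x<R : All (λ z → κ x < κ z) R
    x<R = AllPairs.head (proj₁ (proj₂ sorted-split))

    x∈S : x ∈ S
    x∈S = subst (x ∈_) (sym S≡) (∈-++⁺ʳ T (here refl))

    ℓ∉T : ℓ ∉ map proj₂ T
    ℓ∉T ℓ∈T = All.lookup (All.lookup (proj₂ (proj₂ (AllPairs-++⁻ (map proj₂ T)
      (subst Unique (trans (cong (map proj₂) S≡) (map-++ proj₂ T (x ∷ R))) unique))))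
      ℓ∈T) (here refl) refl

    gℓ≤ : toℕ (g ⟨ ℓ ⟩) ≤ length T
    gℓ≤ = begin
      toℕ (g ⟨ ℓ ⟩)                                      ≤⟨ atMost x∈S ⟩
      count (lower? x) S                                 ≡⟨ cong (count (lower? x)) S≡ ⟩
      count (lower? x) (T ++ x ∷ R)                      ≡⟨ count-++ (lower? x) T (x ∷ R) ⟩
      count (lower? x) T + count (lower? x) (x ∷ R)
        ≡⟨ cong (count (lower? x) T +_) (count-none (lower? x) (x ∷ R) none) ⟩
      count (lower? x) T + 0                             ≡⟨ ℕ.+-identityʳ _ ⟩
      count (lower? x) T                                 ≤⟨ length-filter (lower? x) T ⟩
      length T                                           ∎
      where
      open ℕ.≤-Reasoning
      none : ∀ {z} → z ∈ x ∷ R → ¬ κ z < κ x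
      none (here refl) = ℕ.n≮n _
      none (there z∈R) = ℕ.<⇒≯ (All.lookup x<R z∈R)

    window : ∀ {b} → b ∈ Bₘ → Σ[ c ∈ ℕ ] (κ x ≤ κ (c , b) × κ (c , b) ≤ n + key n a s)
    window {b} b∈ with new-sound b∈ | ∈-map⁻ proj₂ (complete b)
    ... | b∉T , s≤s gb≤ | z@(c , _) , z∈S , refl
      with ∈-++⁻ T (subst (z ∈_) S≡ z∈S)
    ...   | inj₁ z∈T = contradiction (∈-map⁺ proj₂ z∈T) b∉T
    ...   | inj₂ z∈R = c , x≤z z∈R , ℕ.≮⇒≥ λ z> → contradiction gb≤ (ℕ.<⇒≱ (begin-strict
      length T                     ≡⟨ count-all (farLower? z) T (far z>) ⟨
      count (farLower? z) T        ≤⟨ ℕ.m≤m+n _ _ ⟩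
      count (farLower? z) T + count (farLower? z) (x ∷ R)   ≡⟨ count-++ (farLower? z) T (x ∷ R) ⟨
      count (farLower? z) (T ++ x ∷ R)   ≡⟨ cong (count (farLower? z)) S≡ ⟨
      count (farLower? z) S        <⟨ atLeast z∈S (positive c z>) ⟩
      toℕ (g ⟨ b ⟩)                ∎))
      where
      open ℕ.≤-Reasoning
      x≤z : ∀ {z} → z ∈ x ∷ R → κ x ≤ κ z
      x≤z (here refl) = ℕ.≤-refl
      x≤z (there z∈R) = ℕ.<⇒≤ (All.lookup x<R z∈R)
      far : n + key n a s < κ z → ∀ {u} → u ∈ T → n + κ u < κ z
      far z> u∈T = ℕ.≤-<-trans (ℕ.+-monoʳ-≤ n (All.lookup T≤ u∈T)) z>
      positive : ∀ c → n + key n a s < κ (c , b) → 1 ≤ c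
      -- Keys in area 0 are at most n, so such a letter is never above the window.
      positive zero    z> = contradiction z>
        (ℕ.≤⇒≯ (ℕ.≤-trans (ℕ.m∸n≤m n (toℕ b)) (ℕ.m≤m+n n _)))
      positive (suc _) _  = s≤s z≤n

    cons : ∀ {σ} → σ ≡ ℓ →
           σ ∷ pmajFrom g (toℕ σ) (filter (λ b → ¬? (b Fin.≟ σ)) Bₘ) (tabulate (e ∘ suc))
             ≡ ℓ ∷ map proj₂ R
    cons refl = cong (ℓ ∷_) (pmajFrom-sorted (T ∷ʳ x) R {a = proj₁ x} (e ∘ suc)
      (trans S≡ (sym (++-assoc T [ x ] R))) refl
      (λ i → trans (e≡ (suc i)) (trans (ℕ.+-suc (length T) (toℕ i))
                                       (cong (_+ toℕ i) (sym (length-∷ʳ T x)))))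
      (ℕ.<⇒≤ (Fin.toℕ<n ℓ))
      (All.++⁺ (All.map (λ u≤ → ℕ.≤-trans u≤ (ℕ.<⇒≤ <x)) T≤) (ℕ.≤-refl ∷ []))
      x<R
      (subst (λ k → All (λ u → toℕ (g ⟨ proj₂ u ⟩) < k) (T ∷ʳ x)) (sym (length-∷ʳ T x))
        (All.++⁺ (All.map ℕ.m<n⇒m<1+n gT<) (s≤s gℓ≤ ∷ [])))
      sound′ compl′)
      where
      sound′ : ∀ {b} → b ∈ filter (λ b → ¬? (b Fin.≟ ℓ)) Bₘ →
               Available (T ∷ʳ x) (length (T ∷ʳ x)) b
      sound′ {b} b∈ with ∈-filter⁻ (λ b → ¬? (b Fin.≟ ℓ)) {xs = Bₘ} b∈
      ... | b∈Bₘ , b≢ℓ with new-sound b∈Bₘ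
      ...   | b∉T , gb< = ∉T∷ʳ , subst (toℕ (g ⟨ b ⟩) <_) (sym (length-∷ʳ T x)) gb<
        where
        ∉T∷ʳ : b ∉ map proj₂ (T ∷ʳ x)
        ∉T∷ʳ b∈T∷ʳ with ∈-++⁻ (map proj₂ T) (subst (b ∈_) (map-++ proj₂ T [ x ]) b∈T∷ʳ)
        ... | inj₁ b∈T         = b∉T b∈T
        ... | inj₂ (here refl) = b≢ℓ refl

      compl′ : ∀ {b} → Available (T ∷ʳ x) (length (T ∷ʳ x)) b →
               b ∈ filter (λ b → ¬? (b Fin.≟ ℓ)) Bₘ
      compl′ {b} (b∉ , gb<) = ∈-filter⁺ (λ b → ¬? (b Fin.≟ ℓ))
        (new-complete
          ( (λ b∈T → b∉ (subst (b ∈_) (sym (map-++ proj₂ T [ x ])) (∈-++⁺ˡ b∈T)))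
          , subst (toℕ (g ⟨ b ⟩) <_) (length-∷ʳ T x) gb<))
        λ { refl → b∉ (subst (b ∈_) (sym (map-++ proj₂ T [ x ]))
                        (∈-++⁺ʳ (map proj₂ T) (here refl))) }

  pmajWord-sorted : n ≡ length S → pmajWord g ≡ map proj₂ S
  pmajWord-sorted n≡ = pmajFrom-sorted [] S {a = 0} {s = n} id refl n≡ (λ _ → refl) ℕ.≤-refl []
    (All.tabulate λ {x} _ → positive x) [] (λ ()) (λ { (_ , ()) })
    where
    positive : ∀ x → key n 0 n < κ x
    positive (a , ℓ) = ℕ.<-≤-trans
      (key-label 0 (Fin.toℕ<n ℓ) ℕ.≤-refl) (κ-mono a)
      where
      κ-mono : ∀ a → key n 0 (toℕ ℓ) ≤ key n a (toℕ ℓ)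
      κ-mono a = ℕ.+-monoˡ-≤ (n ∸ toℕ ℓ) z≤n

-- Paths as words

-- The truncation in `h ∸ 1` never takes effect on a path that stays weakly above the diagonal.
climb : ℕ → Path n → ℕ
climb h []        = h
climb h (N _ ∷ P) = climb (suc h) P
climb h (E ∷ P)   = climb (h ∸ 1) P

-- The north steps, each given by its height above the diagonal and its label.
word : ℕ → Path n → List (ℕ × Fin n)
word h []        = []
word h (N ℓ ∷ P) = (h , ℓ) ∷ word (suc h) P
word h (E ∷ P)   = word (h ∸ 1) P

climb-++ : ∀ h (A B : Path n) → climb h (A ++ B) ≡ climb (climb h A) B
climb-++ h []        B = refl
climb-++ h (N _ ∷ A) B = climb-++ (suc h) A B
climb-++ h (E ∷ A)   B = climb-++ (h ∸ 1) A B

word-++ : ∀ h (A B : Path n) → word h (A ++ B) ≡ word h A ++ word (climb h A) B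
word-++ h []        B = refl
word-++ h (N ℓ ∷ A) B = cong ((h , ℓ) ∷_) (word-++ (suc h) A B)
word-++ h (E ∷ A)   B = word-++ (h ∸ 1) A B

labels-word : ∀ h (P : Path n) → map proj₂ (word h P) ≡ labels P
labels-word h []        = refl
labels-word h (N ℓ ∷ P) = cong (ℓ ∷_) (labels-word (suc h) P)
labels-word h (E ∷ P)   = labels-word (h ∸ 1) P

labels-++ : (A B : Path n) → labels (A ++ B) ≡ labels A ++ labels B
labels-++ []        B = refl
labels-++ (N ℓ ∷ A) B = cong (ℓ ∷_) (labels-++ A B)
labels-++ (E ∷ A)   B = labels-++ A B

#N-++ : (A B : Path n) → #N (A ++ B) ≡ #N A + #N B
#N-++ A B = trans (cong length (labels-++ A B)) (length-++ (labels A))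

#E-++ : (A B : Path n) → #E (A ++ B) ≡ #E A + #E B
#E-++ []        B = refl
#E-++ (N _ ∷ A) B = #E-++ A B
#E-++ (E ∷ A)   B = cong suc (#E-++ A B)

∈-word⁻ : ∀ h (P : Path n) {z} → z ∈ word h P →
          ∃₂ λ A B → P ≡ A ++ N (proj₂ z) ∷ B × proj₁ z ≡ climb h A
∈-word⁻ h (N ℓ ∷ P) (here refl) = [] , P , refl , refl
∈-word⁻ h (N ℓ ∷ P) (there z∈) with ∈-word⁻ (suc h) P z∈
... | A , B , refl , eq = N ℓ ∷ A , B , refl , eq
∈-word⁻ h (E ∷ P) z∈ with ∈-word⁻ (h ∸ 1) P z∈
... | A , B , refl , eq = E ∷ A , B , refl , eq

-- Dyck b h P: the path P leads from height h down to the diagonal without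
-- crossing it, labels increase along its columns, and its first label is at
-- least b (counting from zero) if P begins with a north step.
data Dyck {n} : ℕ → ℕ → Path n → Set where
  []    : ∀ {b} → Dyck b 0 []
  north : ∀ {b h ℓ P} → b ≤ toℕ ℓ → Dyck (suc (toℕ ℓ)) (suc h) P → Dyck b h (N ℓ ∷ P)
  east  : ∀ {b h P} → Dyck 0 h P → Dyck b (suc h) (E ∷ P)

dyck-suffix : ∀ {b h} (A : Path n) {B} → Dyck b h (A ++ B) → ∃ λ b′ → Dyck b′ (climb h A) B
dyck-suffix []        D           = _ , D
dyck-suffix (N _ ∷ A) (north _ D) = dyck-suffix A D
dyck-suffix (E ∷ A)   (east D)    = dyck-suffix A D

-- Scanning the word from its first letter, whose area is 0, the last letter
-- before the key first reaches that of x has a key within n of it, because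
-- keys increase by less than n from one letter to the next.
companion : ∀ (A : Path n) {ℓ B} → Dyck 0 0 (A ++ N ℓ ∷ B) → 1 ≤ climb 0 A →
            let x = climb 0 A , ℓ in
            ∃ λ y → y ∈ word 0 A × κ y < κ x × κ x < n + κ y
companion {n} (N ν ∷ A₀) {ℓ} {B} (north _ D₀) 1≤a = scan A₀ refl D₀ (here refl) there
  (κ-area (0 , ν) x 1≤a) (inj₂ (refl , refl))
  where
  x = climb 1 A₀ , ℓ
  Companion = ∃ λ y → y ∈ (0 , ν) ∷ word 1 A₀ × κ y < κ x × κ x < n + κ y

  near : ∀ {c β b h δ} → h ≤ c ⊎ (h ≡ suc c × b ≡ suc (toℕ β)) → b ≤ toℕ δ →
         κ (h , δ) < n + κ (c , β)
  near {c} {β} {h = h} {δ} st b≤δ = subst (κ (h , δ) <_) (sym (key-suc n c (toℕ β))) (lt st b≤δ)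
    where
    lt : ∀ {b} → h ≤ c ⊎ (h ≡ suc c × b ≡ suc (toℕ β)) → b ≤ toℕ δ → κ (h , δ) < κ (suc c , β)
    lt (inj₁ h≤c)          _   = κ-area (h , δ) (suc c , β) (s≤s h≤c)
    lt (inj₂ (refl , refl)) β<δ = κ-label (suc c) β<δ

  -- `y` is the last north step seen so far. In the final disjunction, either an east step has
  -- followed it, so that the height has come back to at most its area, or the path stands directly
  -- on top of it, so that a next label in this column must exceed its label.
  scan : ∀ {b h y} (A : Path n) → climb h A ≡ climb 1 A₀ → Dyck b h (A ++ N ℓ ∷ B) →
         y ∈ (0 , ν) ∷ word 1 A₀ →
         (∀ {z} → z ∈ word h A → z ∈ (0 , ν) ∷ word 1 A₀) → κ y < κ x →
         h ≤ proj₁ y ⊎ (h ≡ suc (proj₁ y) × b ≡ suc (toℕ (proj₂ y))) → Companion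
  scan [] refl (north b≤ _) y∈ _ y<x st = _ , y∈ , y<x , near st b≤
  scan {h = h} (N δ ∷ A) eq (north b≤ D) y∈ sub y<x st with κ (h , δ) ℕ.<? κ x
  ... | yes z<x = scan A eq D (sub (here refl)) (sub ∘ there) z<x (inj₂ (refl , refl))
  ... | no  z≮x = _ , y∈ , y<x , ℕ.≤-<-trans (ℕ.≮⇒≥ z≮x) (near st b≤)
  scan (E ∷ A) eq (east D) y∈ sub y<x st = scan A eq D y∈ sub y<x (inj₁ (lower st))
    where
    lower : ∀ {h c b} {X : Set b} → suc h ≤ c ⊎ (suc h ≡ suc c × X) → h ≤ c
    lower (inj₁ sh≤c)      = ℕ.<⇒≤ sh≤c
    lower (inj₂ (refl , _)) = ℕ.≤-refl

-- The number of labels preceding ℓ in the reading word and not forming a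
-- diagonal inversion with it, in the path A ++ N ℓ ∷ B.
value : Path n → Fin n → Path n → ℕ
value A ℓ B = count (lower? x) (word 0 A) + count (farLower? x) (word (suc a) B)
  where
  a = climb 0 A
  x = a , ℓ

count-split : ∀ {P : ℕ × Fin n → Set} (P? : Decidable P) (A : Path n) {ℓ B} →
  ¬ P (climb 0 A , ℓ) →
  count P? (word 0 (A ++ N ℓ ∷ B)) ≡ count P? (word 0 A) + count P? (word (suc (climb 0 A)) B)
count-split P? A {ℓ} {B} ¬px = trans (cong (count P?) (word-++ 0 A (N ℓ ∷ B)))
  (trans (count-skip P? (word 0 A) ¬px) (count-++ P? (word 0 A) _))

value-≤ : ∀ (A : Path n) ℓ B →
          value A ℓ B ≤ count (lower? (climb 0 A , ℓ)) (word 0 (A ++ N ℓ ∷ B))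
value-≤ {n} A ℓ B = ℕ.≤-trans
  (ℕ.+-monoʳ-≤ (count (lower? x) (word 0 A))
    (count-mono (farLower? x) (lower? x) (word (suc (climb 0 A)) B)
      λ {z} _ → ℕ.≤-<-trans (ℕ.m≤n+m (κ z) n)))
  (ℕ.≤-reflexive (sym (count-split (lower? x) A (ℕ.n≮n _))))
  where x = climb 0 A , ℓ

-- The `companion` stands to the left of ℓ and is lower without being far lower: the left-hand side
-- misses it and `value` counts it.
value-> : ∀ (A : Path n) ℓ B → Dyck 0 0 (A ++ N ℓ ∷ B) → 1 ≤ climb 0 A →
          count (farLower? (climb 0 A , ℓ)) (word 0 (A ++ N ℓ ∷ B)) < value A ℓ B
value-> {n} A ℓ B D 1≤a with companion A D 1≤a
... | y , y∈ , y<x , x<y = subst (_< value A ℓ B)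
  (sym (count-split (farLower? x) A (ℕ.≤⇒≯ (ℕ.m≤n+m (κ x) n))))
  (ℕ.+-monoˡ-< _ (count-strict (farLower? x) (lower? x) (word 0 A)
    (λ {z} _ → ℕ.≤-<-trans (ℕ.m≤n+m (κ z) n)) y∈ (ℕ.<⇒≯ x<y) y<x))
  where x = climb 0 A , ℓ

-- Encodes g P: g has, at every label of P, the value which φ gives to it.
Encodes : PF n → Path n → Set
Encodes g P = ∀ {A ℓ B} → P ≡ A ++ N ℓ ∷ B → toℕ (g ⟨ ℓ ⟩) ≡ value A ℓ B

-- Removing the letter of greatest key

-- A north step directly after ℓ would have greater area, hence a greater key.
peak : ∀ (A : Path n) {ℓ B} → Dyck 0 0 (A ++ N ℓ ∷ B) →
       (∀ {z} → z ∈ word 0 (A ++ N ℓ ∷ B) → κ z ≤ κ (climb 0 A , ℓ)) →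
       ∃ λ B′ → B ≡ E ∷ B′
peak A {ℓ} {B} D max with dyck-suffix A D
... | _ , north _ (east _) = _ , refl
... | _ , north {P = N μ ∷ B′} _ (north _ _) = contradiction
  (max (subst (_ ∈_) (sym (word-++ 0 A _)) (∈-++⁺ʳ (word 0 A) (there (here refl)))))
  (ℕ.<⇒≱ (κ-area (climb 0 A , ℓ) (suc (climb 0 A) , μ) (ℕ.n<1+n _)))

-- The only danger is a north step μ right after the peak, which then joins the column below. It has
-- the same area as ℓ and no greater key, so its label is at least ℓ and respects the bound that ℓ
-- respected.
remove-peak : ∀ {b h} (A : Path n) {ℓ B} → Dyck b h (A ++ N ℓ ∷ E ∷ B) →
              (∀ {z} → z ∈ word (climb h A) B → κ z ≤ κ (climb h A , ℓ)) →
              Dyck b h (A ++ B)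
remove-peak (N _ ∷ A) (north b≤ D) max = north b≤ (remove-peak A D max)
remove-peak (E ∷ A)   (east D)     max = east (remove-peak A D max)
remove-peak [] (north _ (east []))       max = []
remove-peak [] (north _ (east (east D))) max = east D
remove-peak {h = h} [] {ℓ} {N μ ∷ _} (north b≤ (east (north _ D))) max
  with key-≤⁻ {b = h} (Fin.toℕ<n μ) (ℕ.<⇒≤ (Fin.toℕ<n ℓ)) (max (here refl))
... | inj₁ h<h      = contradiction h<h (ℕ.n≮n h)
... | inj₂ (_ , ℓ≤μ) = north (ℕ.≤-trans b≤ ℓ≤μ) D

count-remove : ∀ {P : ℕ × Fin n → Set} (P? : Decidable P) h (A : Path n) {ℓ B} →
  ¬ P (climb h A , ℓ) →
  count P? (word h (A ++ N ℓ ∷ E ∷ B)) ≡ count P? (word h (A ++ B))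
count-remove P? h A {ℓ} {B} ¬px = trans (cong (count P?) (word-++ h A (N ℓ ∷ E ∷ B)))
  (trans (count-skip P? (word h A) ¬px) (cong (count P?) (sym (word-++ h A B))))

-- A letter of greatest key is neither lower nor far lower than any other, so no other value counts
-- it; and removing N E leaves all other heights unchanged.
encodes-remove : ∀ {g : PF n} (A : Path n) {ℓ B} → Encodes g (A ++ N ℓ ∷ E ∷ B) →
                 (∀ {z} → z ∈ word 0 (A ++ B) → κ z ≤ κ (climb 0 A , ℓ)) →
                 Encodes g (A ++ B)
encodes-remove {n} {g} A {ℓ} {B} enc max {C} {μ} {D} eq with ++-≡-split A eq
... | inj₁ (M , refl , refl) = trans
  (enc {C} {μ} {M ++ N ℓ ∷ E ∷ B} (++-assoc C (N μ ∷ M) _))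
  (cong (count (lower? y) (word 0 C) +_) (count-remove (farLower? y) (suc (climb 0 C)) M
    (subst (λ a → ¬ n + κ (a , ℓ) < κ y) (climb-++ 0 C (N μ ∷ M))
      (ℕ.≤⇒≯ (ℕ.≤-trans (max y∈) (ℕ.m≤n+m _ n))))))
  where
  y = climb 0 C , μ
  y∈ : y ∈ word 0 (A ++ B)
  y∈ = subst (y ∈_) (sym (trans (cong (word 0) eq) (word-++ 0 C (N μ ∷ D))))
         (∈-++⁺ʳ (word 0 C) (here refl))
... | inj₂ (M , refl , refl) = trans
  (enc {A ++ N ℓ ∷ E ∷ M} {μ} {D} (sym (++-assoc A (N ℓ ∷ E ∷ M) (N μ ∷ D))))
  (same (trans (climb-++ 0 A (N ℓ ∷ E ∷ M)) (sym (climb-++ 0 A M))))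
  where
  y = climb 0 (A ++ M) , μ
  y∈ : y ∈ word 0 (A ++ B)
  y∈ = subst (y ∈_) (sym (trans (cong (word 0) eq) (word-++ 0 (A ++ M) (N μ ∷ D))))
         (∈-++⁺ʳ (word 0 (A ++ M)) (here refl))
  same : climb 0 (A ++ N ℓ ∷ E ∷ M) ≡ climb 0 (A ++ M) →
         value (A ++ N ℓ ∷ E ∷ M) μ D ≡ value (A ++ M) μ D
  same eq rewrite eq = cong (_+ count (farLower? y) (word (suc (climb 0 (A ++ M))) D))
    (count-remove (lower? y) 0 A (ℕ.≤⇒≯ (max y∈)))

-- Labelled Dyck paths

dyck-#E : ∀ {b h} {P : Path n} → Dyck b h P → #E P ≡ h + #N P
dyck-#E []                  = refl
dyck-#E (north {h = h} _ D) = trans (dyck-#E D) (sym (ℕ.+-suc h _))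
dyck-#E (east D)            = cong suc (dyck-#E D)

dyck-above : ∀ {b h} {P : Path n} → Dyck b h P → ∀ k → #E (take k P) ≤ h + #N (take k P)
dyck-above D           zero    = z≤n
dyck-above []          (suc k) = z≤n
dyck-above (north {h = h} _ D) (suc k) = ℕ.≤-trans (dyck-above D k) (ℕ.≤-reflexive (sym (ℕ.+-suc h _)))
dyck-above (east D)    (suc k) = s≤s (dyck-above D k)

dyck-column : ∀ {b h} (A : Path n) {ℓ B} → Dyck b h (A ++ N ℓ ∷ B) → #E A ≡ 0 → b ≤ toℕ ℓ
dyck-column []        (north b≤ _) _  = b≤
dyck-column (N _ ∷ A) (north b≤ D) eq =
  ℕ.≤-trans b≤ (ℕ.<⇒≤ (dyck-column A D eq))

below-split : ∀ (A : Path n) {ℓ B} → ℓ ∉ labels A → below (A ++ N ℓ ∷ B) ℓ ≡ A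
below-split [] {ℓ} _ with ℓ Fin.≟ ℓ
... | yes refl = refl
... | no  ℓ≢ℓ  = contradiction refl ℓ≢ℓ
below-split (N μ ∷ A) {ℓ} ℓ∉ with μ Fin.≟ ℓ
... | yes refl = contradiction (here refl) ℓ∉
... | no  _    = cong (N μ ∷_) (below-split A (ℓ∉ ∘ there))
below-split (E ∷ A) ℓ∉ = cong (E ∷_) (below-split A ℓ∉)

unique-split : ∀ (A : Path n) {ℓ B} → Unique (labels (A ++ N ℓ ∷ B)) →
               ℓ ∉ labels A × ℓ ∉ labels B
unique-split A {ℓ} {B} u with AllPairs-++⁻ (labels A) (subst Unique (labels-++ A (N ℓ ∷ B)) u)
... | _ , ℓ∉B ∷ _ , A∩B = (λ ℓ∈ → All.lookup (All.lookup A∩B ℓ∈) (here refl) refl) ,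
                          (λ ℓ∈ → All.lookup ℓ∉B ℓ∈ refl)

row-split : ∀ (A : Path n) {ℓ B} → Unique (labels (A ++ N ℓ ∷ B)) →
            row (A ++ N ℓ ∷ B) ℓ ≡ suc (#N A)
row-split A u = cong (suc ∘ #N) (below-split A (proj₁ (unique-split A u)))

column-split : ∀ (A : Path n) {ℓ B} → Unique (labels (A ++ N ℓ ∷ B)) →
               column (A ++ N ℓ ∷ B) ℓ ≡ suc (#E A)
column-split A u = cong (suc ∘ #E) (below-split A (proj₁ (unique-split A u)))

∈-labels⁻ : ∀ (P : Path n) {ℓ} → ℓ ∈ labels P → ∃₂ λ A B → P ≡ A ++ N ℓ ∷ B
∈-labels⁻ (N _ ∷ P) (here refl) = [] , P , refl
∈-labels⁻ (N μ ∷ P) (there ℓ∈) with ∈-labels⁻ P ℓ∈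
... | A , B , refl = N μ ∷ A , B , refl
∈-labels⁻ (E ∷ P) ℓ∈ with ∈-labels⁻ P ℓ∈
... | A , B , refl = E ∷ A , B , refl

dyck⇒labelled : ∀ {m} {P : Path n} → Dyck 0 0 P → Unique (labels P) → #N P ≡ m →
                IsLabelledDyck m P
dyck⇒labelled {P = P} D u N≡m = record
  { norths     = N≡m
  ; easts      = trans (dyck-#E D) N≡m
  ; above      = dyck-above D
  ; distinct   = u
  ; increasing = increasing
  }
  where
  increasing : ∀ {ℓ μ} → ℓ ∈ labels P → μ ∈ labels P →
               column P ℓ ≡ column P μ → row P ℓ < row P μ → ℓ Fin.< μ
  increasing {ℓ} {μ} ℓ∈ μ∈ col≡ row< with ∈-labels⁻ P ℓ∈
  ... | A , B , refl with ∈-++⁻ (labels A) (subst (μ ∈_) (labels-++ A (N ℓ ∷ B)) μ∈)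
  ...   | inj₂ (here refl) = contradiction row< (ℕ.n≮n _)
  ...   | inj₁ μ∈A with ∈-labels⁻ A μ∈A
  ...     | A₁ , A₂ , refl = contradiction row< (ℕ.<⇒≯ (begin-strict
    row (A ++ N ℓ ∷ B) μ    ≡⟨ cong (λ P → row P μ) (++-assoc A₁ (N μ ∷ A₂) _) ⟩
    row (A₁ ++ N μ ∷ A₂ ++ N ℓ ∷ B) μ
                            ≡⟨ row-split A₁ (subst (Unique ∘ labels) (++-assoc A₁ (N μ ∷ A₂) _) u) ⟩
    suc (#N A₁)             <⟨ s≤s (ℕ.m<m+n (#N A₁) (s≤s z≤n)) ⟩
    suc (#N A₁ + suc (#N A₂)) ≡⟨ cong suc (#N-++ A₁ (N μ ∷ A₂)) ⟨
    suc (#N A)              ≡⟨ row-split A u ⟨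
    row (A ++ N ℓ ∷ B) ℓ    ∎))
    where open ℕ.≤-Reasoning
  increasing {ℓ} {μ} ℓ∈ μ∈ col≡ row< | A , B , refl | inj₂ (there μ∈B) with ∈-labels⁻ B μ∈B
  ...     | B₁ , B₂ , refl with dyck-suffix A D
  ...       | _ , north _ D′ = dyck-column B₁ D′ (ℕ.+-cancelˡ-≡ (#E A) (#E B₁) 0 (begin
    #E A + #E B₁            ≡⟨ #E-++ A (N ℓ ∷ B₁) ⟨
    #E (A ++ N ℓ ∷ B₁)      ≡⟨ ℕ.suc-injective (begin
      suc (#E (A ++ N ℓ ∷ B₁))  ≡⟨ column-split (A ++ N ℓ ∷ B₁) (subst (Unique ∘ labels) assoc u) ⟨
      column ((A ++ N ℓ ∷ B₁) ++ N μ ∷ B₂) μ ≡⟨ cong (λ P → column P μ) assoc ⟨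
      column P μ            ≡⟨ col≡ ⟨
      column P ℓ            ≡⟨ column-split A u ⟩
      suc (#E A)            ∎) ⟩
    #E A                    ≡⟨ ℕ.+-identityʳ _ ⟨
    #E A + 0                ∎))
    where
    open ≡-Reasoning
    assoc = sym (++-assoc A (N ℓ ∷ B₁) (N μ ∷ B₂))

climb-balance : ∀ h (A : Path n) {B} → (∀ k → #E (take k (A ++ B)) ≤ h + #N (take k (A ++ B))) →
                climb h A + #E A ≡ h + #N A
climb-balance h []        _     = refl
climb-balance h (N ℓ ∷ A) above = trans
  (climb-balance (suc h) A λ k → ℕ.≤-trans (above (suc k)) (ℕ.≤-reflexive (ℕ.+-suc h _)))
  (sym (ℕ.+-suc h _))
climb-balance zero    (E ∷ A) above = contradiction (above 1) λ ()
climb-balance (suc h) (E ∷ A) above = trans (ℕ.+-suc _ _)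
  (cong suc (climb-balance h A λ k → s≤s⁻¹ (above (suc k))))

-- Diagonal inversions

-- The strict order of the dinv reading word, with the column standing for the value of f.
Precedes : Path n → Fin n → Fin n → Set
Precedes P μ ℓ = area P μ < area P ℓ ⊎ (area P μ ≡ area P ℓ × column P μ < column P ℓ)

precedes? : (P : Path n) (μ ℓ : Fin n) → Dec (Precedes P μ ℓ)
precedes? P μ ℓ = area P μ ℕ.<? area P ℓ ⊎-dec
  (area P μ ℕ.≟ area P ℓ ×-dec column P μ ℕ.<? column P ℓ)

-- Replaces the truncated difference in `area` by an equation; comparisons of rows, columns and
-- areas then follow by cancellation.
located : ∀ {m} {P : Path n} → IsLabelledDyck m P → ∀ A {ℓ B} → P ≡ A ++ N ℓ ∷ B →
          area P ℓ ≡ climb 0 A × column P ℓ + area P ℓ ≡ row P ℓ × row P ℓ ≡ suc (#N A)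
located {P = P} D A {ℓ} refl = area≡ , trans (cong (column P ℓ +_) area≡) sum , row≡
  where
  open IsLabelledDyck D
  row≡ : row P ℓ ≡ suc (#N A)
  row≡ = row-split A distinct
  sum : column P ℓ + climb 0 A ≡ row P ℓ
  sum = trans (cong (_+ climb 0 A) (column-split A distinct))
    (trans (cong suc (trans (ℕ.+-comm (#E A) _) (climb-balance 0 A above))) (sym row≡))
  area≡ : area P ℓ ≡ climb 0 A
  area≡ = trans (cong (_∸ column P ℓ) (sym sum)) (ℕ.m+n∸m≡n (column P ℓ) _)

module _ {n} {P : Path n} {μ ℓ : Fin n}
         (μ-located : column P μ + area P μ ≡ row P μ)
         (ℓ-located : column P ℓ + area P ℓ ≡ row P ℓ)
  where

  column-<⁺ : area P ℓ ≤ area P μ → row P μ < row P ℓ → column P μ < column P ℓ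
  column-<⁺ a≤ r< = ℕ.+-cancelʳ-< (area P μ) _ _
    (ℕ.<-≤-trans (subst₂ _<_ (sym μ-located) (sym ℓ-located) r<) (ℕ.+-monoʳ-≤ (column P ℓ) a≤))

  column-<⁻ : area P μ ≤ area P ℓ → column P μ < column P ℓ → row P μ < row P ℓ
  column-<⁻ a≤ c< = subst₂ _<_ μ-located ℓ-located (ℕ.+-mono-<-≤ c< a≤)

module _ {n} {P : Path n} {μ ℓ : Fin n}
         (μ-located : column P μ + area P μ ≡ row P μ)
         (ℓ-located : column P ℓ + area P ℓ ≡ row P ℓ)
  where

  private
    z x : ℕ × Fin n
    z = area P μ , μ
    x = area P ℓ , ℓ

  -- In an inversion the letter further left has the greater key: it has the smaller label in the
  -- case of equal areas and the greater area in the other case.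
  earlier-¬dinv : row P μ < row P ℓ → κ z < κ x → ¬ Dinv P μ ℓ
  earlier-¬dinv r< z<x with κ-<⁻ {x = z} {x} z<x
  ... | inj₁ a< = λ where
    (inj₁ (_ , inj₁ (_ , eq)))  → ℕ.<-irrefl eq a<
    (inj₁ (_ , inj₂ (c< , eq))) → ℕ.<⇒≱ r< (let open ℕ.≤-Reasoning in ℕ.≤-pred (begin
        suc (row P ℓ)                      ≡⟨ cong suc ℓ-located ⟨
        suc (column P ℓ + area P ℓ)        ≡⟨ cong (λ a → suc (column P ℓ + a)) eq ⟨
        suc (column P ℓ + (area P μ + 1))  ≡⟨ cong (λ a → suc (column P ℓ + a)) (ℕ.+-comm _ 1) ⟩
        suc (column P ℓ + suc (area P μ))  ≡⟨ cong suc (ℕ.+-suc (column P ℓ) _) ⟩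
        suc (suc (column P ℓ) + area P μ)  ≤⟨ s≤s (ℕ.+-monoˡ-≤ (area P μ) c<) ⟩
        suc (column P μ + area P μ)        ≡⟨ cong suc μ-located ⟩
        suc (row P μ)                      ∎))
    (inj₂ (_ , inj₁ (_ , eq)))  → ℕ.<-irrefl (sym eq) a<
    (inj₂ (_ , inj₂ (_ , eq)))  → ℕ.<⇒≱ a< (ℕ.≤-trans (ℕ.m≤m+n _ 1) (ℕ.≤-reflexive eq))
  ... | inj₂ (eq , ℓ<μ) = λ where
    (inj₁ (μ<ℓ , _))            → ℕ.<⇒≯ μ<ℓ ℓ<μ
    (inj₂ (_ , inj₁ (c< , _)))  → ℕ.<⇒≯ r<
      (column-<⁻ {P = P} ℓ-located μ-located (ℕ.≤-reflexive (sym eq)) c<)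
    (inj₂ (_ , inj₂ (_ , eq′))) → ℕ.m≢1+m+n (area P ℓ) {0} (trans (sym (trans eq′ eq)) (ℕ.+-suc _ 0))

  -- The keys of the two letters of an inversion differ by less than n.
  later-¬dinv : n + κ z < κ x → ¬ Dinv P μ ℓ
  later-¬dinv z<x with κ-<⁻ {x = suc (area P μ) , μ} {x}
                         (subst (_< κ x) (key-suc n (area P μ) (toℕ μ)) z<x)
  ... | inj₁ sa< = λ where
    (inj₁ (_ , inj₁ (_ , eq)))  → ℕ.<-irrefl eq (ℕ.<⇒≤ sa<)
    (inj₁ (_ , inj₂ (_ , eq)))  → ℕ.<-irrefl (trans (ℕ.+-comm 1 _) eq) sa<
    (inj₂ (_ , inj₁ (_ , eq)))  → ℕ.<-irrefl (sym eq) (ℕ.<⇒≤ sa<)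
    (inj₂ (_ , inj₂ (_ , eq)))  → ℕ.<⇒≱ (ℕ.<⇒≤ sa<) (ℕ.≤-trans (ℕ.m≤m+n _ 1) (ℕ.≤-reflexive eq))
  ... | inj₂ (sa≡ , ℓ<μ) = λ where
    (inj₁ (μ<ℓ , _))            → ℕ.<⇒≯ μ<ℓ ℓ<μ
    (inj₂ (_ , inj₁ (_ , eq)))  → ℕ.<-irrefl (sym eq) (ℕ.≤-reflexive sa≡)
    (inj₂ (_ , inj₂ (_ , eq)))  → ℕ.<⇒≱ (ℕ.≤-reflexive sa≡) (ℕ.≤-trans (ℕ.m≤m+n _ 1) (ℕ.≤-reflexive eq))

  -- Conversely, if the letter on the left has the greater key, by less than n, the pair is an
  -- inversion: with equal areas, or with areas differing by one and the smaller label on the right.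
  -- A difference of exactly n would mean equal labels.
  later-¬dinv⁻ : row P ℓ < row P μ → κ z < κ x → ¬ Dinv P μ ℓ → n + κ z < κ x
  later-¬dinv⁻ r< z<x ¬dinv with κ-<⁻ {x = z} {x} z<x
  ... | inj₂ (eq , ℓ<μ) = contradiction
    (inj₂ (ℓ<μ , inj₁ (column-<⁺ {P = P} ℓ-located μ-located (ℕ.≤-reflexive eq) r< , sym eq))) ¬dinv
  ... | inj₁ a< = subst (_< κ x) (sym (key-suc n (area P μ) (toℕ μ))) lt
    where
    z⁺ : ℕ × Fin n
    z⁺ = suc (area P μ) , μ
    lt : κ z⁺ < κ x
    lt with ℕ.m≤n⇒m<n∨m≡n a<
    ... | inj₁ sa< = κ-area z⁺ x sa<
    ... | inj₂ sa≡ with Fin.<-cmp μ ℓ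
    ...   | tri> _ _ ℓ<μ = subst (λ a → κ z⁺ < κ (a , ℓ)) sa≡ (κ-label (suc (area P μ)) ℓ<μ)
    ...   | tri≈ _ refl _ = contradiction r< (ℕ.n≮n _)
    ...   | tri< μ<ℓ _ _ = contradiction
      (inj₁ (μ<ℓ , inj₂ (ℕ.+-cancelʳ-< (area P μ) _ _ (begin-strict
        column P ℓ + area P μ        <⟨ ℕ.+-monoʳ-< (column P ℓ) a< ⟩
        column P ℓ + area P ℓ        ≡⟨ ℓ-located ⟩
        row P ℓ                      <⟨ r< ⟩
        row P μ                      ≡⟨ μ-located ⟨
        column P μ + area P μ        ∎) , trans (ℕ.+-comm _ 1) sa≡))) ¬dinv
      where open ℕ.≤-Reasoning

  earlier-precedes⁻ : row P μ < row P ℓ → Precedes P μ ℓ → ¬ Dinv P μ ℓ → κ z < κ x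
  earlier-precedes⁻ r< (inj₁ a<) _ = κ-area z x a<
  earlier-precedes⁻ r< (inj₂ (eq , c<)) ¬dinv with Fin.<-cmp μ ℓ
  ... | tri> _ _ ℓ<μ = subst (λ a → κ z < κ (a , ℓ)) eq (κ-label (area P μ) ℓ<μ)
  ... | tri≈ _ refl _ = contradiction r< (ℕ.n≮n _)
  ... | tri< μ<ℓ _ _ = contradiction (inj₁ (μ<ℓ , inj₁ (c< , eq))) ¬dinv

  earlier-precedes : row P μ < row P ℓ → κ z < κ x → Precedes P μ ℓ
  earlier-precedes r< z<x with κ-<⁻ {x = z} {x} z<x
  ... | inj₁ a<       = inj₁ a<
  ... | inj₂ (eq , _) = inj₂ (eq , column-<⁺ {P = P} μ-located ℓ-located (ℕ.≤-reflexive (sym eq)) r<)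

  later-precedes⁻ : row P ℓ < row P μ → Precedes P μ ℓ → κ z < κ x
  later-precedes⁻ r< (inj₁ a<)        = κ-area z x a<
  later-precedes⁻ r< (inj₂ (eq , c<)) = contradiction
    (column-<⁻ {P = P} μ-located ℓ-located (ℕ.≤-reflexive eq) c<) (ℕ.<⇒≯ r<)

  later-precedes : n + κ z < κ x → Precedes P μ ℓ
  later-precedes z<x with κ-<⁻ {x = suc (area P μ) , μ} {x}
                            (subst (_< κ x) (key-suc n (area P μ) (toℕ μ)) z<x)
  ... | inj₁ sa<       = inj₁ (ℕ.<⇒≤ sa<)
  ... | inj₂ (sa≡ , _) = inj₁ (ℕ.≤-reflexive sa≡)

module _ {m} {P : Path n} (D : IsLabelledDyck m P) A {ℓ B} (P≡ : P ≡ A ++ N ℓ ∷ B) where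

  private
    x-located = located D A P≡

  earlier-located : ∀ {z} → z ∈ word 0 A → proj₁ z ≡ area P (proj₂ z) ×
            column P (proj₂ z) + area P (proj₂ z) ≡ row P (proj₂ z) ×
            row P (proj₂ z) < row P ℓ
  earlier-located {a , μ} z∈ with ∈-word⁻ 0 A z∈
  ... | A₁ , A₂ , A≡ , a≡ with located D A₁ {μ} {A₂ ++ N ℓ ∷ B}
    (trans P≡ (trans (cong (_++ N ℓ ∷ B) A≡) (++-assoc A₁ (N μ ∷ A₂) _)))
  ...   | area≡ , sum , row≡ = trans a≡ (sym area≡) , sum , (begin-strict
    row P μ                    ≡⟨ row≡ ⟩
    suc (#N A₁)                <⟨ s≤s (ℕ.m<m+n (#N A₁) (s≤s z≤n)) ⟩
    suc (#N A₁ + suc (#N A₂))  ≡⟨ cong suc (#N-++ A₁ (N μ ∷ A₂)) ⟨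
    suc (#N (A₁ ++ N μ ∷ A₂))  ≡⟨ cong (suc ∘ #N) A≡ ⟨
    suc (#N A)                 ≡⟨ proj₂ (proj₂ x-located) ⟨
    row P ℓ                    ∎)
    where open ℕ.≤-Reasoning

  later-located : ∀ {z} → z ∈ word (suc (climb 0 A)) B → proj₁ z ≡ area P (proj₂ z) ×
          column P (proj₂ z) + area P (proj₂ z) ≡ row P (proj₂ z) ×
          row P ℓ < row P (proj₂ z)
  later-located {a , μ} z∈ with ∈-word⁻ _ B z∈
  ... | B₁ , B₂ , B≡ , a≡ with located D (A ++ N ℓ ∷ B₁) {μ} {B₂}
    (trans P≡ (trans (cong (λ B → A ++ N ℓ ∷ B) B≡) (sym (++-assoc A (N ℓ ∷ B₁) _))))
  ...   | area≡ , sum , row≡ = trans a≡ (trans (sym (climb-++ 0 A (N ℓ ∷ B₁))) (sym area≡)) ,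
          sum , (begin-strict
    row P ℓ                    ≡⟨ proj₂ (proj₂ x-located) ⟩
    suc (#N A)                 <⟨ s≤s (ℕ.m<m+n (#N A) (s≤s z≤n)) ⟩
    suc (#N A + suc (#N B₁))   ≡⟨ cong suc (#N-++ A (N ℓ ∷ B₁)) ⟨
    suc (#N (A ++ N ℓ ∷ B₁))   ≡⟨ row≡ ⟨
    row P μ                    ∎)
    where open ℕ.≤-Reasoning

  private
    x : ℕ × Fin n
    x = area P ℓ , ℓ

    sum-ℓ = proj₁ (proj₂ x-located)

  value-area : value A ℓ B ≡
               count (lower? x) (word 0 A) + count (farLower? x) (word (suc (climb 0 A)) B)
  value-area = cong (λ a → count (lower? (a , ℓ)) (word 0 A) +
                           count (farLower? (a , ℓ)) (word (suc (climb 0 A)) B))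
    (sym (proj₁ x-located))

  reading? : Decidable (λ (μ : Fin n) → Precedes P μ ℓ × ¬ Dinv P μ ℓ)
  reading? μ = precedes? P μ ℓ ×-dec ¬? (dinv? P μ ℓ)

  value-reading : count reading? (labels P) ≡ value A ℓ B
  value-reading = begin
    count reading? (labels P)                           ≡⟨ cong (count reading? ∘ labels) P≡ ⟩
    count reading? (labels (A ++ N ℓ ∷ B))              ≡⟨ cong (count reading?) (labels-word 0 (A ++ N ℓ ∷ B)) ⟨
    count reading? (map proj₂ (word 0 (A ++ N ℓ ∷ B)))  ≡⟨ count-map proj₂ reading? (word 0 (A ++ N ℓ ∷ B)) ⟩
    count (reading? ∘ proj₂) (word 0 (A ++ N ℓ ∷ B))    ≡⟨ count-split (reading? ∘ proj₂) A ℓ-irreflexive ⟩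
    count (reading? ∘ proj₂) (word 0 A) + count (reading? ∘ proj₂) (word (suc (climb 0 A)) B)
      ≡⟨ cong₂ _+_
           (count-cong (reading? ∘ proj₂) (lower? x) (word 0 A) earlier⁺ earlier⁻)
           (count-cong (reading? ∘ proj₂) (farLower? x) (word (suc (climb 0 A)) B) later⁺ later⁻) ⟩
    count (lower? x) (word 0 A) + count (farLower? x) (word (suc (climb 0 A)) B)
      ≡⟨ value-area ⟨
    value A ℓ B                                         ∎
    where
    open ≡-Reasoning
    ℓ-irreflexive : ¬ (Precedes P ℓ ℓ × ¬ Dinv P ℓ ℓ)
    ℓ-irreflexive (inj₁ a< , _)       = ℕ.n≮n _ a<
    ℓ-irreflexive (inj₂ (_ , c<) , _) = ℕ.n≮n _ c<

    earlier⁺ : ∀ {z} → z ∈ word 0 A → Precedes P (proj₂ z) ℓ × ¬ Dinv P (proj₂ z) ℓ → κ z < κ x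
    earlier⁺ z∈ (pre , ¬dinv) with earlier-located z∈
    ... | refl , sum , row< = earlier-precedes⁻ {P = P} sum sum-ℓ row< pre ¬dinv

    earlier⁻ : ∀ {z} → z ∈ word 0 A → κ z < κ x → Precedes P (proj₂ z) ℓ × ¬ Dinv P (proj₂ z) ℓ
    earlier⁻ z∈ z<x with earlier-located z∈
    ... | refl , sum , row< = earlier-precedes {P = P} sum sum-ℓ row< z<x ,
                              earlier-¬dinv {P = P} sum sum-ℓ row< z<x

    later⁺ : ∀ {z} → z ∈ word (suc (climb 0 A)) B →
             Precedes P (proj₂ z) ℓ × ¬ Dinv P (proj₂ z) ℓ → n + κ z < κ x
    later⁺ z∈ (pre , ¬dinv) with later-located z∈
    ... | refl , sum , row< = later-¬dinv⁻ {P = P} sum sum-ℓ row<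
                                (later-precedes⁻ {P = P} sum sum-ℓ row< pre) ¬dinv

    later⁻ : ∀ {z} → z ∈ word (suc (climb 0 A)) B → n + κ z < κ x →
             Precedes P (proj₂ z) ℓ × ¬ Dinv P (proj₂ z) ℓ
    later⁻ z∈ z<x with later-located z∈
    ... | refl , sum , row< = later-precedes {P = P} sum sum-ℓ z<x , later-¬dinv {P = P} sum sum-ℓ z<x

-- Since ℓ has the greatest key, it avoids every letter to its left, and it avoids a letter to its
-- right exactly when that letter is far lower. These are the letters that `value` counts.
avoided-value : ∀ {m} A {ℓ : Fin n} {B σs} → let Q = A ++ N ℓ ∷ E ∷ B in
  IsLabelledDyck m Q → (∀ {z} → z ∈ word 0 (A ++ B) → κ z < κ (climb 0 A , ℓ)) →
  σs ↭ labels (A ++ B) → avoided Q σs ℓ ≡ value A ℓ (E ∷ B)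
avoided-value {n} A {ℓ} {B} {σs} D below-x σs↭ = begin
  count avoid? σs                                ≡⟨ count-↭ avoid? σs↭ ⟩
  count avoid? (labels (A ++ B))                 ≡⟨ cong (count avoid?) (labels-word 0 (A ++ B)) ⟨
  count avoid? (map proj₂ (word 0 (A ++ B)))     ≡⟨ count-map proj₂ avoid? (word 0 (A ++ B)) ⟩
  count (avoid? ∘ proj₂) (word 0 (A ++ B))       ≡⟨ cong (count (avoid? ∘ proj₂)) (word-++ 0 A B) ⟩
  count (avoid? ∘ proj₂) (word 0 A ++ word (climb 0 A) B) ≡⟨ count-++ (avoid? ∘ proj₂) (word 0 A) _ ⟩
  count (avoid? ∘ proj₂) (word 0 A) + count (avoid? ∘ proj₂) (word (climb 0 A) B)
    ≡⟨ cong₂ _+_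
         (count-cong (avoid? ∘ proj₂) (lower? x) (word 0 A) (λ z∈ _ → lowerˡ z∈) earlier⁻)
         (count-cong (avoid? ∘ proj₂) (farLower? x) (word (climb 0 A) B) later⁺ later⁻) ⟩
  count (lower? x) (word 0 A) + count (farLower? x) (word (climb 0 A) B)
    ≡⟨ value-area D A refl ⟨
  value A ℓ (E ∷ B)                              ∎
  where
  open ≡-Reasoning
  Q = A ++ N ℓ ∷ E ∷ B
  x : ℕ × Fin n
  x = area Q ℓ , ℓ
  avoid? : Decidable (λ (μ : Fin n) → ¬ Dinv Q μ ℓ)
  avoid? μ = ¬? (dinv? Q μ ℓ)

  ℓ-located = located D A refl
  sum-ℓ = proj₁ (proj₂ ℓ-located)

  lower : ∀ {z} → z ∈ word 0 A ++ word (climb 0 A) B → κ z < κ x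
  lower {z} z∈ = subst (λ a → κ z < κ (a , ℓ)) (sym (proj₁ ℓ-located))
    (below-x (subst (z ∈_) (sym (word-++ 0 A B)) z∈))

  lowerˡ : ∀ {z} → z ∈ word 0 A → κ z < κ x
  lowerˡ = lower ∘ ∈-++⁺ˡ

  earlier⁻ : ∀ {z} → z ∈ word 0 A → κ z < κ x → ¬ Dinv Q (proj₂ z) ℓ
  earlier⁻ z∈ z<x with earlier-located D A refl z∈
  ... | refl , sum , row< = earlier-¬dinv {P = Q} sum sum-ℓ row< z<x

  later⁺ : ∀ {z} → z ∈ word (climb 0 A) B → ¬ Dinv Q (proj₂ z) ℓ → n + κ z < κ x
  later⁺ z∈ ¬dinv with later-located D A {B = E ∷ B} refl z∈
  ... | refl , sum , row< = later-¬dinv⁻ {P = Q} sum sum-ℓ row< (lower (∈-++⁺ʳ (word 0 A) z∈)) ¬dinv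

  later⁻ : ∀ {z} → z ∈ word (climb 0 A) B → n + κ z < κ x → ¬ Dinv Q (proj₂ z) ℓ
  later⁻ z∈ z<x with later-located D A {B = E ∷ B} refl z∈
  ... | refl , sum , row< = later-¬dinv {P = Q} sum sum-ℓ z<x

-- Insertion points

-- Each north step of M starts below height p, and one that reaches height p
-- has a label greater than ℓ; from there M descends again unless it ends.
no-return : ∀ {b h p ℓ} (M : Path n) {C} → Dyck b h (M ++ C) → climb h M ≡ p →
            h ≤ p → M ≢ [] → (∀ {z} → z ∈ word h M → n + κ z < κ (p , ℓ)) →
            ∃₂ λ M′ ν → M ≡ M′ ∷ʳ N ν × ℓ Fin.< ν
no-return {n} {p = p} {ℓ} M {C} D eq h≤p M≢[] far = depart M D eq h≤p M≢[] far
  where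
  far⁻ : ∀ {h} ν → n + κ (h , ν) < κ (p , ℓ) → suc h < p ⊎ (suc h ≡ p × ℓ Fin.< ν)
  far⁻ {h} ν lt = κ-<⁻ {x = suc h , ν} {p , ℓ} (subst (_< κ (p , ℓ)) (key-suc n h (toℕ ν)) lt)

  Final : Path n → Set
  Final M = ∃₂ λ M′ ν → M ≡ M′ ∷ʳ N ν × ℓ Fin.< ν

  cons : ∀ s {M} → Final M → Final (s ∷ M)
  cons s (M′ , ν , refl , ℓ<ν) = s ∷ M′ , ν , refl , ℓ<ν

  inside : ∀ {b h} (M : Path n) → Dyck b h (M ++ C) → climb h M ≡ p → h < p →
           (∀ {z} → z ∈ word h M → n + κ z < κ (p , ℓ)) → Final M
  inside []      _        refl h<p _   = contradiction h<p (ℕ.n≮n _)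
  inside (E ∷ M) (east D) eq   h<p far = cons E (inside M D eq (ℕ.<⇒≤ h<p) far)
  inside (N ν ∷ M) (north _ D) eq h<p far with far⁻ ν (far (here refl))
  ... | inj₁ sh<p = cons (N ν) (inside M D eq sh<p (far ∘ there))
  inside (N ν ∷ [])        _                    _  _   _   | inj₂ (_ , ℓ<ν) = [] , ν , refl , ℓ<ν
  inside (N ν ∷ E ∷ M)     (north _ (east D))   eq h<p far | inj₂ _ =
    cons (N ν) (cons E (inside M D eq h<p (far ∘ there)))
  inside (N ν ∷ N ν′ ∷ M)  _                    _  _   far | inj₂ (refl , _)
    with far⁻ ν′ (far (there (here refl)))
  ... | inj₁ lt       = contradiction (ℕ.n<1+n _) (ℕ.<⇒≯ lt)
  ... | inj₂ (eq , _) = contradiction eq λ ()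

  depart : ∀ {b h} (M : Path n) → Dyck b h (M ++ C) → climb h M ≡ p → h ≤ p → M ≢ [] →
          (∀ {z} → z ∈ word h M → n + κ z < κ (p , ℓ)) → Final M
  depart []      _        _  _   M≢[] _   = contradiction refl M≢[]
  depart (E ∷ M) (east D) eq h≤p _    far = cons E (inside M D eq h≤p far)
  depart (N ν ∷ M) D eq h≤p _ far with ℕ.m≤n⇒m<n∨m≡n h≤p
  ... | inj₁ h<p  = inside (N ν ∷ M) D eq h<p far
  ... | inj₂ refl with far⁻ ν (far (here refl))
  ...   | inj₁ lt       = contradiction (ℕ.n<1+n _) (ℕ.<⇒≯ lt)
  ...   | inj₂ (eq′ , _) = contradiction eq′ λ ()

module _ {g : PF n} {σs : List (Fin n)} {P : Path n} {ℓ : Fin n} {p : ℕ}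
         (D : Dyck 0 0 P) (σs↭ : σs ↭ labels P) (p≡ : ascents (σs ∷ʳ ℓ) ≡ p)
         (below-x : ∀ {z} → z ∈ word 0 P → κ z < κ (p , ℓ))
  where

  private
    x : ℕ × Fin n
    x = p , ℓ

  point-height : ∀ {k} → InsertionPoint g σs P ℓ k → climb 0 (take k P) ≡ p
  point-height {k} point = ℕ.+-cancelʳ-≡ (#E (take k P)) _ _ (begin
    climb 0 (take k P) + #E (take k P)  ≡⟨ climb-balance 0 (take k P) {drop k P}
      (subst (λ P → ∀ j → #E (take j P) ≤ #N (take j P)) (sym (take++drop≡id k P)) (dyck-above D)) ⟩
    #N (take k P)                       ≡⟨ onDiagonal ⟩
    #E (take k P) + ascents (σs ∷ʳ ℓ)   ≡⟨ cong (#E (take k P) +_) p≡ ⟩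
    #E (take k P) + p                   ≡⟨ ℕ.+-comm (#E (take k P)) p ⟩
    p + #E (take k P)                   ∎)
    where
    open ≡-Reasoning
    open InsertionPoint point

  -- All labels to the left of the insertion point are avoided.
  point-value : ∀ {k} → InsertionPoint g σs P ℓ k →
    length (word 0 (take k P)) + count (farLower? x) (word p (drop k P)) ≡ toℕ (g ⟨ ℓ ⟩)
  point-value {k} point = begin
    length (word 0 A) + count (farLower? x) (word p B)
      ≡⟨ cong₂ _+_ (sym (count-all (lower? x) (word 0 A) lower-A)) refl ⟩
    count (lower? x) (word 0 A) + count (farLower? x) (word p B)
      ≡⟨ cong (λ a → count (lower? (a , ℓ)) (word 0 A) + count (farLower? (a , ℓ)) (word a B))
              (sym height) ⟩
    value A ℓ (E ∷ B)
      ≡⟨ avoided-value A {B = B} {σs} suitable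
           (λ {z} z∈ → subst (λ a → κ z < κ (a , ℓ)) (sym height)
             (below-x (subst (λ P → z ∈ word 0 P) (take++drop≡id k P) z∈)))
           (subst (λ P → σs ↭ labels P) (sym (take++drop≡id k P)) σs↭) ⟨
    avoided (insert P k ℓ) σs ℓ
      ≡⟨ avoids ⟩
    toℕ (g ⟨ ℓ ⟩) ∎
    where
    open ≡-Reasoning
    open InsertionPoint point
    A = take k P
    B = drop k P
    height = point-height point
    lower-A : ∀ {z} → z ∈ word 0 A → κ z < κ x
    lower-A {z} z∈ = below-x (subst (λ P → z ∈ word 0 P) (take++drop≡id k P)
      (subst (z ∈_) (sym (word-++ 0 A B)) (∈-++⁺ˡ z∈)))

  -- Moving the insertion point from j to k > j strictly increases the number
  -- of avoided inversions.
  no-later-point : ∀ {j k} → InsertionPoint g σs P ℓ j → InsertionPoint g σs P ℓ k → ¬ j < k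
  no-later-point {j} {k} point-j point-k j<k
    with take-drop-split P j<k (InsertionPoint.onPath point-k)
  ... | M , drop≡ , take≡ , M≢[] = contradiction ν<ℓ (ℕ.<⇒≯ ℓ<ν)
    where
    A = take j P
    B = drop k P

    height-M : climb p M ≡ p
    height-M = begin
      climb p M            ≡⟨ cong (λ h → climb h M) (point-height point-j) ⟨
      climb (climb 0 A) M  ≡⟨ climb-++ 0 A M ⟨
      climb 0 (A ++ M)     ≡⟨ cong (climb 0) take≡ ⟨
      climb 0 (take k P)   ≡⟨ point-height point-k ⟩
      p                    ∎
      where open ≡-Reasoning

    -- The point j avoids only the far lower letters of M, the point k avoids all of M, and both
    -- avoid the same number in total.
    far-M : count (farLower? x) (word p M) ≡ length (word p M)
    far-M = ℕ.+-cancelʳ-≡ fB _ _ (ℕ.+-cancelˡ-≡ (length (word 0 A)) _ _ (begin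
      length (word 0 A) + (count (farLower? x) (word p M) + fB)
        ≡⟨ cong (length (word 0 A) +_) (count-++ (farLower? x) (word p M) (word p B)) ⟨
      length (word 0 A) + count (farLower? x) (word p M ++ word p B)
        ≡⟨ cong (λ h → length (word 0 A) + count (farLower? x) (word p M ++ word h B)) height-M ⟨
      length (word 0 A) + count (farLower? x) (word p M ++ word (climb p M) B)
        ≡⟨ cong (λ w → length (word 0 A) + count (farLower? x) w)
             (trans (cong (word p) drop≡) (word-++ p M B)) ⟨
      length (word 0 A) + count (farLower? x) (word p (drop j P))
        ≡⟨ trans (point-value point-j) (sym (point-value point-k)) ⟩
      length (word 0 (take k P)) + fB
        ≡⟨ cong (λ w → length w + fB) (trans (cong (word 0) take≡) (word-++ 0 A M)) ⟩
      length (word 0 A ++ word (climb 0 A) M) + fB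
        ≡⟨ cong (λ h → length (word 0 A ++ word h M) + fB) (point-height point-j) ⟩
      length (word 0 A ++ word p M) + fB
        ≡⟨ cong (_+ fB) (length-++ (word 0 A)) ⟩
      length (word 0 A) + length (word p M) + fB
        ≡⟨ ℕ.+-assoc (length (word 0 A)) _ fB ⟩
      length (word 0 A) + (length (word p M) + fB) ∎))
      where
      open ≡-Reasoning
      fB = count (farLower? x) (word p B)

    dyck-M : ∃ λ b → Dyck b p (M ++ B)
    dyck-M = map₂ (λ {b} → subst₂ (Dyck b) (point-height point-j) drop≡)
      (dyck-suffix A (subst (Dyck 0 0) (sym (take++drop≡id j P)) D))

    last-step = no-return M (proj₂ dyck-M) height-M ℕ.≤-refl M≢[]
                  (count-full (farLower? x) (word p M) far-M)
    M′  = proj₁ last-step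
    ν   = proj₁ (proj₂ last-step)
    M≡  = proj₁ (proj₂ (proj₂ last-step))
    ℓ<ν = proj₂ (proj₂ (proj₂ last-step))

    -- Inserting at k would put ℓ directly on top of the greater label ν, so k is not suitable.
    Q = (A ++ M′) ++ N ν ∷ N ℓ ∷ E ∷ B

    Q≡ : insert P k ℓ ≡ Q
    Q≡ = begin
      take k P ++ N ℓ ∷ E ∷ B               ≡⟨ cong (_++ N ℓ ∷ E ∷ B) take≡ ⟩
      (A ++ M) ++ N ℓ ∷ E ∷ B               ≡⟨ cong (λ M → (A ++ M) ++ N ℓ ∷ E ∷ B) M≡ ⟩
      (A ++ M′ ∷ʳ N ν) ++ N ℓ ∷ E ∷ B       ≡⟨ cong (_++ N ℓ ∷ E ∷ B) (++-assoc A M′ [ N ν ]) ⟨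
      ((A ++ M′) ∷ʳ N ν) ++ N ℓ ∷ E ∷ B     ≡⟨ ++-assoc (A ++ M′) [ N ν ] _ ⟩
      Q                                     ∎
      where open ≡-Reasoning

    Q′ = (A ++ M′ ∷ʳ N ν) ++ N ℓ ∷ E ∷ B

    Q≡′ : Q ≡ Q′
    Q≡′ = trans (sym (++-assoc (A ++ M′) [ N ν ] _)) (cong (_++ N ℓ ∷ E ∷ B) (++-assoc A M′ [ N ν ]))

    suitable-Q : IsLabelledDyck (suc (length σs)) Q
    suitable-Q = subst (IsLabelledDyck _) Q≡ (InsertionPoint.suitable point-k)

    open IsLabelledDyck suitable-Q

    distinct′ : Unique (labels Q′)
    distinct′ = subst (Unique ∘ labels) Q≡′ distinct

    ν<ℓ : ν Fin.< ℓ
    ν<ℓ = increasing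
      (subst (ν ∈_) (sym (labels-++ (A ++ M′) _)) (∈-++⁺ʳ (labels (A ++ M′)) (here refl)))
      (subst (ℓ ∈_) (sym (labels-++ (A ++ M′) _)) (∈-++⁺ʳ (labels (A ++ M′)) (there (here refl))))
      (begin-equality
        column Q ν                    ≡⟨ column-split (A ++ M′) distinct ⟩
        suc (#E (A ++ M′))            ≡⟨ cong suc (ℕ.+-identityʳ _) ⟨
        suc (#E (A ++ M′) + 0)        ≡⟨ cong suc (#E-++ (A ++ M′) [ N ν ]) ⟨
        suc (#E ((A ++ M′) ∷ʳ N ν))   ≡⟨ cong (suc ∘ #E) (++-assoc A M′ [ N ν ]) ⟩
        suc (#E (A ++ M′ ∷ʳ N ν))     ≡⟨ column-split (A ++ M′ ∷ʳ N ν) distinct′ ⟨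
        column Q′ ℓ                   ≡⟨ cong (λ Q → column Q ℓ) Q≡′ ⟨
        column Q ℓ                    ∎)
      (begin-strict
        row Q ν                       ≡⟨ row-split (A ++ M′) distinct ⟩
        suc (#N (A ++ M′))            <⟨ s≤s (ℕ.m<m+n _ (s≤s z≤n)) ⟩
        suc (#N (A ++ M′) + 1)        ≡⟨ cong suc (#N-++ (A ++ M′) [ N ν ]) ⟨
        suc (#N ((A ++ M′) ∷ʳ N ν))   ≡⟨ cong (suc ∘ #N) (++-assoc A M′ [ N ν ]) ⟩
        suc (#N (A ++ M′ ∷ʳ N ν))     ≡⟨ row-split (A ++ M′ ∷ʳ N ν) distinct′ ⟨
        row Q′ ℓ                      ≡⟨ cong (λ Q → row Q ℓ) Q≡′ ⟨
        row Q ℓ                       ∎)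
      where open ℕ.≤-Reasoning

  point-unique : ∀ {j k} → InsertionPoint g σs P ℓ j → InsertionPoint g σs P ℓ k → j ≡ k
  point-unique {j} {k} point-j point-k with ℕ.<-cmp j k
  ... | tri< j<k _ _ = contradiction j<k (no-later-point point-j point-k)
  ... | tri≈ _ j≡k _ = j≡k
  ... | tri> _ _ k<j = contradiction k<j (no-later-point point-k point-j)

-- Rebuilding a path from its letters in increasing order of key

ascents-∷ʳ : ∀ (w : List (Fin n)) t x →
             ascents (w ∷ʳ t ∷ʳ x) ≡ ascents (w ∷ʳ t) + (if does (t Fin.<? x) then 1 else 0)
ascents-∷ʳ []          t x = ℕ.+-comm _ 0
ascents-∷ʳ (y ∷ [])    t x = trans (cong ((if does (y Fin.<? t) then 1 else 0) +_) (ascents-∷ʳ [] t x))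
                               (sym (ℕ.+-assoc (if does (y Fin.<? t) then 1 else 0) 0 _))
ascents-∷ʳ (y ∷ z ∷ w) t x = trans (cong ((if does (y Fin.<? z) then 1 else 0) +_) (ascents-∷ʳ (z ∷ w) t x))
                               (sym (ℕ.+-assoc (if does (y Fin.<? z) then 1 else 0) _ _))

-- If the key rises by less than n, then either the area stays and the label descends, or the area
-- grows by one and the label ascends.
ascents-area : ∀ (w : List (Fin n)) {t x : ℕ × Fin n} → κ t < κ x → κ x < n + κ t →
               proj₁ t ≡ ascents (w ∷ʳ proj₂ t) → proj₁ x ≡ ascents (w ∷ʳ proj₂ t ∷ʳ proj₂ x)
ascents-area {n} w {a , μ} {b , ν} t<x x<t a≡
  with κ-<⁻ {x = a , μ} {b , ν} t<x
     | κ-<⁻ {x = b , ν} {suc a , μ} (subst (κ (b , ν) <_) (key-suc n a (toℕ μ)) x<t)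
... | inj₂ (refl , ν<μ) | _ = trans a≡ (sym (trans (ascents-∷ʳ w μ ν)
  (trans (cong (λ c → ascents (w ∷ʳ μ) + (if c then 1 else 0)) (dec-false (μ Fin.<? ν) (ℕ.<⇒≯ ν<μ)))
    (ℕ.+-identityʳ _))))
... | inj₁ a<b | inj₁ b<sa = contradiction a<b (ℕ.≤⇒≯ (s≤s⁻¹ b<sa))
... | inj₁ a<b | inj₂ (refl , μ<ν) = trans (cong suc a≡) (sym (trans (ascents-∷ʳ w μ ν)
  (trans (cong (λ c → ascents (w ∷ʳ μ) + (if c then 1 else 0)) (dec-true (μ Fin.<? ν) μ<ν))
    (ℕ.+-comm _ 1))))

labels-↭ : ∀ {T} (P : Path n) → T ↭ word 0 P → map proj₂ T ↭ labels P
labels-↭ P T↭ = subst (_ ↭_) (labels-word 0 P) (map⁺ proj₂ T↭)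

last-max : ∀ {R : X → X → Set} {xs x} → AllPairs R (xs ∷ʳ x) → All (λ y → R y x) xs
last-max {xs = xs} rs = All.map (λ { (r ∷ []) → r }) (proj₂ (proj₂ (AllPairs-++⁻ xs rs)))

-- The last letter of T is a peak of P; the induction runs on P without it, with `m` as structural
-- measure. The second component is carried along because the diagonal of the next insertion is
-- given by a number of ascents, which has to be recognised as an area.
builds : ∀ {g : PF n} m T {P} → length T ≡ m → Dyck 0 0 P → T ↭ word 0 P →
         AllPairs (λ z x → κ z < κ x) T → Unique (map proj₂ T) → Encodes g P →
         Builds g (map proj₂ T) P ×
         (∀ {T′ x} → T ≡ T′ ∷ʳ x → proj₁ x ≡ ascents (map proj₂ T′ ∷ʳ proj₂ x))
builds m T T≡ D T↭ sorted unique enc with initLast T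
builds m .[] T≡ [] T↭ sorted unique enc | [] =
  start , λ {T′} eq → contradiction (sym eq) (∷ʳ≢[] T′)
builds m .[] T≡ (north _ _) T↭ sorted unique enc | [] with () ← ∈-resp-↭ (↭-sym T↭) (here refl)
builds zero .(T ∷ʳ x) T≡ _ _ _ _ _ | T ∷ʳ′ x with () ← trans (sym (length-∷ʳ T x)) T≡
builds {n} {g} (suc m) .(T ∷ʳ x) {P} T≡ D T↭ sorted unique enc | T ∷ʳ′ x@(a , ℓ)
  with ∈-word⁻ 0 P (∈-resp-↭ T↭ (∈-++⁺ʳ T (here refl)))
... | A , C , refl , refl with peak A D ≤x
  where
  ≤x : ∀ {z} → z ∈ word 0 P → κ z ≤ κ x
  ≤x z∈ with ∈-++⁻ T (∈-resp-↭ (↭-sym T↭) z∈)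
  ... | inj₁ z∈T         = ℕ.<⇒≤ (All.lookup (last-max sorted) z∈T)
  ... | inj₂ (here refl) = ℕ.≤-refl
...   | B , refl =
  subst₂ (Builds g) (sym (map-++ proj₂ T [ x ])) insert≡
    (extend (proj₁ IH) (length A , point ,
      λ point′ → point-unique D′ (labels-↭ (A ++ B) T↭′) ascents≡ below-x point point′)) ,
  last-area
  where
  T↭′ : T ↭ word 0 (A ++ B)
  T↭′ = subst₂ _↭_ (++-identityʳ T) (sym (word-++ 0 A B))
    (drop-mid T (word 0 A) (subst (T ∷ʳ x ↭_) (word-++ 0 A (N ℓ ∷ E ∷ B)) T↭))

  below-x : ∀ {z} → z ∈ word 0 (A ++ B) → κ z < κ x
  below-x z∈ = All.lookup (last-max sorted) (∈-resp-↭ (↭-sym T↭′) z∈)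

  D′ : Dyck 0 0 (A ++ B)
  D′ = remove-peak A D λ z∈ →
    ℕ.<⇒≤ (below-x (subst (_ ∈_) (sym (word-++ 0 A B)) (∈-++⁺ʳ (word 0 A) z∈)))

  sorted′ : AllPairs (λ z x → κ z < κ x) T
  sorted′ = proj₁ (AllPairs-++⁻ T sorted)

  unique′ : Unique (map proj₂ T)
  unique′ = proj₁ (AllPairs-++⁻ (map proj₂ T) (subst Unique (map-++ proj₂ T [ x ]) unique))

  IH = builds {g = g} m T (ℕ.suc-injective (trans (sym (length-∷ʳ T x)) T≡))
    D′ T↭′ sorted′ unique′ (encodes-remove {g = g} A enc (ℕ.<⇒≤ ∘ below-x))

  -- The `companion` of x survives the removal of the peak, and t has the greatest key among what
  -- remains.
  near : ∀ {T′ t} → T ≡ T′ ∷ʳ t → 1 ≤ climb 0 A → κ x < n + κ t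
  near {T′} {t} refl 1≤a with companion A D 1≤a
  ... | y , y∈ , _ , x<y = ℕ.<-≤-trans x<y (ℕ.+-monoʳ-≤ n (y≤t
        (∈-++⁻ T′ (∈-resp-↭ (↭-sym T↭′) (subst (y ∈_) (sym (word-++ 0 A B)) (∈-++⁺ˡ y∈))))))
    where
    y≤t : ∀ {y} → y ∈ T′ ⊎ y ∈ [ t ] → κ y ≤ κ t
    y≤t (inj₁ y∈T′)        = ℕ.<⇒≤ (All.lookup (last-max sorted′) y∈T′)
    y≤t (inj₂ (here refl)) = ℕ.≤-refl

  nonempty : 1 ≤ climb 0 A → T ≢ []
  nonempty 1≤a refl with companion A D 1≤a
  ... | y , y∈ , _ with () ← ∈-resp-↭ (↭-sym T↭′) (subst (y ∈_) (sym (word-++ 0 A B)) (∈-++⁺ˡ y∈))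

  area≡ : ∀ {T′} → T ≡ T′ → InitLast T′ → climb 0 A ≡ ascents (map proj₂ T′ ∷ʳ ℓ)
  area≡ T≡[] [] with climb 0 A ℕ.≟ 0
  ... | yes a≡0 = a≡0
  ... | no  a≢0 = contradiction T≡[] (nonempty (ℕ.n≢0⇒n>0 a≢0))
  area≡ T≡ (T′ ∷ʳ′ t) = subst (λ w → climb 0 A ≡ ascents (w ∷ʳ ℓ)) (sym (map-++ proj₂ T′ [ t ]))
    (ascents-area (map proj₂ T′) t<x close (proj₂ IH T≡))
    where
    t<x : κ t < κ x
    t<x = below-x (∈-resp-↭ T↭′ (subst (t ∈_) (sym T≡) (∈-++⁺ʳ T′ (here refl))))
    close : κ x < n + κ t
    close with climb 0 A ℕ.≟ 0
    ... | no  a≢0 = near T≡ (ℕ.n≢0⇒n>0 a≢0)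
    ... | yes a≡0 = subst (κ x <_) (sym (key-suc n (proj₁ t) (toℕ (proj₂ t))))
      (κ-area x (suc (proj₁ t) , proj₂ t) (subst (_< suc (proj₁ t)) (sym a≡0) (s≤s z≤n)))

  ascents≡ : ascents (map proj₂ T ∷ʳ ℓ) ≡ climb 0 A
  ascents≡ = sym (area≡ refl (initLast T))

  last-area : ∀ {T′ x′} → T ∷ʳ x ≡ T′ ∷ʳ x′ → proj₁ x′ ≡ ascents (map proj₂ T′ ∷ʳ proj₂ x′)
  last-area {T′} eq with ∷ʳ-injective T T′ eq
  ... | refl , refl = sym ascents≡

  insert≡ : insert (A ++ B) (length A) ℓ ≡ P
  insert≡ = cong₂ (λ A B → A ++ N ℓ ∷ E ∷ B) (take-length-++ A) (drop-length-++ A)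

  unique-P : Unique (labels P)
  unique-P = Permutationₛ.Unique-resp-↭ (setoid (Fin n)) (↭⇒↭ₛ (labels-↭ P T↭)) unique

  length-P : #N P ≡ suc (length (map proj₂ T))
  length-P = begin
    #N P                             ≡⟨ ↭-length (labels-↭ P T↭) ⟨
    length (map proj₂ (T ∷ʳ x))      ≡⟨ length-map proj₂ (T ∷ʳ x) ⟩
    length (T ∷ʳ x)                  ≡⟨ length-∷ʳ T x ⟩
    suc (length T)                   ≡⟨ cong suc (length-map proj₂ T) ⟨
    suc (length (map proj₂ T))       ∎
    where open ≡-Reasoning

  labelled-P : IsLabelledDyck (suc (length (map proj₂ T))) P
  labelled-P = dyck⇒labelled D unique-P length-P

  point : InsertionPoint g (map proj₂ T) (A ++ B) ℓ (length A)
  point = record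
    { onPath     = length-++-≤ˡ A
    ; onDiagonal = begin
        #N (take (length A) (A ++ B))      ≡⟨ cong #N (take-length-++ A) ⟩
        #N A                               ≡⟨ climb-balance 0 A {B} (dyck-above D′) ⟨
        climb 0 A + #E A                   ≡⟨ ℕ.+-comm (climb 0 A) _ ⟩
        #E A + climb 0 A                   ≡⟨ cong₂ _+_ (cong #E (sym (take-length-++ A))) (sym ascents≡) ⟩
        #E (take (length A) (A ++ B)) + ascents (map proj₂ T ∷ʳ ℓ) ∎
    ; suitable   = subst (IsLabelledDyck _) (sym insert≡) labelled-P
    ; avoids     = begin
        avoided (insert (A ++ B) (length A) ℓ) (map proj₂ T) ℓ
                                           ≡⟨ cong (λ Q → avoided Q (map proj₂ T) ℓ) insert≡ ⟩
        avoided P (map proj₂ T) ℓ          ≡⟨ avoided-value A labelled-P below-x (labels-↭ (A ++ B) T↭′) ⟩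
        value A ℓ (E ∷ B)                  ≡⟨ enc refl ⟨
        toℕ (g ⟨ ℓ ⟩)                      ∎
    }
    where open ≡-Reasoning

-- The path of a parking function

-- Columns c P: in P, counting from column c on, each label lies in its column
-- under f.
data Columns (f : PF n) : ℕ → Path n → Set where
  []    : ∀ {c} → Columns f c []
  north : ∀ {c ℓ P} → toℕ (f ⟨ ℓ ⟩) ≡ c → Columns f c P → Columns f c (N ℓ ∷ P)
  east  : ∀ {c P} → Columns f (suc c) P → Columns f c (E ∷ P)

columns-split : ∀ {f : PF n} {c} A {ℓ B} → Columns f c (A ++ N ℓ ∷ B) → toℕ (f ⟨ ℓ ⟩) ≡ c + #E A
columns-split {c = c} [] (north eq _)      = trans eq (sym (ℕ.+-identityʳ c))
columns-split (N _ ∷ A) (north _ C)        = columns-split A C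
columns-split {c = c} (E ∷ A) (east C)     = trans (columns-split A C) (sym (ℕ.+-suc c _))

labels-run : ∀ (xs : List (Fin n)) P → labels ((map N xs ++ [ E ]) ++ P) ≡ xs ++ labels P
labels-run []       P = refl
labels-run (x ∷ xs) P = cong (x ∷_) (labels-run xs P)

columns-run : ∀ {f : PF n} {c} xs {P} → (∀ {x} → x ∈ xs → toℕ (f ⟨ x ⟩) ≡ c) → Columns f (suc c) P →
              Columns f c ((map N xs ++ [ E ]) ++ P)
columns-run []       _  C = east C
columns-run (x ∷ xs) ∈c C = north (∈c (here refl)) (columns-run xs (∈c ∘ there) C)

dyck-run : ∀ {b h h′} (xs : List (Fin n)) {P} → AllPairs Fin._<_ xs → All (λ x → b ≤ toℕ x) xs →
           suc h′ ≡ h + length xs → Dyck 0 h′ P → Dyck b h ((map N xs ++ [ E ]) ++ P)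
dyck-run {h = h} [] _ _ eq D with refl ← trans eq (ℕ.+-identityʳ h) = east D
dyck-run {h = h} (x ∷ xs) (x< ∷ xs<) (b≤ ∷ _) eq D =
  north b≤ (dyck-run xs xs< x< (trans eq (ℕ.+-suc h _)) D)

-- The irrelevant field can be recovered because each inequality is decidable.
is-parking : (f : PF n) → Parking (f ⟨_⟩)
is-parking (mkPF _ p) m = recompute (_ ℕ.≤? _) (p m)

module _ (f : PF n) where

  run : Fin n → Path n
  run i = map N (fiber f i) ++ [ E ]

  left? : ∀ c → Decidable (λ (ℓ : Fin n) → toℕ (f ⟨ ℓ ⟩) < c)
  left? c ℓ = toℕ (f ⟨ ℓ ⟩) ℕ.<? c

  leftOf : ℕ → List (Fin n)
  leftOf c = filter (left? c) (allFin n)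

  leftOf-suc : ∀ i → leftOf (suc (toℕ i)) ↭ leftOf (toℕ i) ++ fiber f i
  leftOf-suc i = filter-↭-++ (left? (toℕ i)) (λ ℓ → f ⟨ ℓ ⟩ Fin.≟ i) (left? (suc (toℕ i)))
    ℕ.m<n⇒m<1+n (λ { refl → ℕ.n<1+n _ }) split (λ { lt refl → ℕ.n≮n _ lt }) (allFin n)
    where
    split : ∀ {ℓ} → toℕ (f ⟨ ℓ ⟩) < suc (toℕ i) → toℕ (f ⟨ ℓ ⟩) < toℕ i ⊎ f ⟨ ℓ ⟩ ≡ i
    split (s≤s le) with ℕ.m≤n⇒m<n∨m≡n le
    ... | inj₁ lt = inj₁ lt
    ... | inj₂ eq = inj₂ (Fin.toℕ-injective eq)

  leftOf-all : leftOf n ≡ allFin n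
  leftOf-all = filter-all (left? n) (All.tabulate λ {ℓ} _ → Fin.toℕ<n (f ⟨ ℓ ⟩))

  leftOf-parking : ∀ i → suc (toℕ i) ≤ length (leftOf (suc (toℕ i)))
  leftOf-parking i = ℕ.≤-trans (is-parking f i)
    (count-mono (λ ℓ → f ⟨ ℓ ⟩ Fin.≤? i) (left? (suc (toℕ i))) (allFin n) (λ _ → s≤s))

  fiber-increasing : ∀ i → AllPairs Fin._<_ (fiber f i)
  fiber-increasing i = AllPairs.filter⁺ _ (AllPairs.tabulate⁺-< id)

  runs-columns : ∀ {k c} (e : Fin k → Fin n) → (∀ i → toℕ (e i) ≡ c + toℕ i) →
                 Columns f c (concatMap run (tabulate e))
  runs-columns {zero}  e e≡ = []
  runs-columns {suc k} {c} e e≡ = columns-run (fiber f (e zero))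
    (λ x∈ → trans (cong toℕ (proj₂ (∈-filter⁻ (λ ℓ → f ⟨ ℓ ⟩ Fin.≟ e zero) {xs = allFin n} x∈)))
                  (trans (e≡ zero) (ℕ.+-identityʳ c)))
    (runs-columns (e ∘ suc) λ i → trans (e≡ (suc i)) (ℕ.+-suc c _))

  runs-labels : ∀ {k c} (e : Fin k → Fin n) → (∀ i → toℕ (e i) ≡ c + toℕ i) → c + k ≡ n →
                leftOf c ++ labels (concatMap run (tabulate e)) ↭ allFin n
  runs-labels {zero} {c} e e≡ c≡n = ↭-reflexive (trans (++-identityʳ _)
    (trans (cong leftOf (trans (sym (ℕ.+-identityʳ c)) c≡n)) leftOf-all))
  runs-labels {suc k} {c} e e≡ c+k≡n = begin
    leftOf c ++ labels (run i ++ rest)          ≡⟨ cong (leftOf c ++_) (labels-run (fiber f i) rest) ⟩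
    leftOf c ++ (fiber f i ++ labels rest)      ≡⟨ ++-assoc (leftOf c) (fiber f i) _ ⟨
    (leftOf c ++ fiber f i) ++ labels rest      ≡⟨ cong (λ c → (leftOf c ++ fiber f i) ++ labels rest) c≡ ⟩
    (leftOf (toℕ i) ++ fiber f i) ++ labels rest ↭⟨ ++⁺ʳ (labels rest) (leftOf-suc i) ⟨
    leftOf (suc (toℕ i)) ++ labels rest         ≡⟨ cong (λ c → leftOf (suc c) ++ labels rest) c≡ ⟨
    leftOf (suc c) ++ labels rest               ↭⟨ runs-labels (e ∘ suc) (λ i → trans (e≡ (suc i)) (ℕ.+-suc c _))
                                                     (trans (sym (ℕ.+-suc c k)) c+k≡n) ⟩
    allFin n                                    ∎
    where
    open PermutationReasoning
    i = e zero
    rest = concatMap run (tabulate (e ∘ suc))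
    c≡ : c ≡ toℕ i
    c≡ = sym (trans (e≡ zero) (ℕ.+-identityʳ c))

  -- On reaching column c the path has made c east steps and one north step for each label in
  -- `leftOf c`, whence the equation for h. The parking condition says that the run of labels in
  -- column c ends at height at least 1, so its east step stays above the diagonal and the
  -- truncation in `h′` is harmless.
  runs-dyck : ∀ {k c h} (e : Fin k → Fin n) → (∀ i → toℕ (e i) ≡ c + toℕ i) → c + k ≡ n →
              h + c ≡ length (leftOf c) → Dyck 0 h (concatMap run (tabulate e))
  runs-dyck {zero} {c} {h} e e≡ c≡n h≡ = subst (λ h → Dyck 0 h []) (sym h≡0) []
    where
    h≡0 : h ≡ 0
    h≡0 with refl ← trans (sym (ℕ.+-identityʳ c)) c≡n =
      ℕ.+-cancelʳ-≡ c h 0 (trans h≡ (trans (cong length leftOf-all) (length-allFin c)))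
  runs-dyck {suc k} {c} {h} e e≡ c+k≡n h≡ = dyck-run (fiber f i) (fiber-increasing i)
    (All.tabulate λ _ → z≤n) h′≡
    (runs-dyck (e ∘ suc) (λ i → trans (e≡ (suc i)) (ℕ.+-suc c _))
      (trans (sym (ℕ.+-suc c k)) c+k≡n)
      (trans (ℕ.+-suc h′ c) (trans (cong (_+ c) h′≡) (sym total))))
    where
    open ≡-Reasoning
    i = e zero
    h′ = h + length (fiber f i) ∸ 1
    c≡ : toℕ i ≡ c
    c≡ = trans (e≡ zero) (ℕ.+-identityʳ c)
    total : length (leftOf (suc c)) ≡ h + length (fiber f i) + c
    total = begin
      length (leftOf (suc c))                       ≡⟨ cong (length ∘ leftOf ∘ suc) c≡ ⟨
      length (leftOf (suc (toℕ i)))                 ≡⟨ ↭-length (leftOf-suc i) ⟩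
      length (leftOf (toℕ i) ++ fiber f i)          ≡⟨ length-++ (leftOf (toℕ i)) ⟩
      length (leftOf (toℕ i)) + length (fiber f i)  ≡⟨ cong (λ c → length (leftOf c) + length (fiber f i)) c≡ ⟩
      length (leftOf c) + length (fiber f i)        ≡⟨ cong (_+ length (fiber f i)) h≡ ⟨
      h + c + length (fiber f i)                    ≡⟨ ℕ.+-assoc h c _ ⟩
      h + (c + length (fiber f i))                  ≡⟨ cong (h +_) (ℕ.+-comm c _) ⟩
      h + (length (fiber f i) + c)                  ≡⟨ ℕ.+-assoc h _ c ⟨
      h + length (fiber f i) + c                    ∎
    h′≡ : suc h′ ≡ h + length (fiber f i)
    h′≡ = ℕ.m+[n∸m]≡n {1} (ℕ.+-cancelʳ-≤ c 1 _
      (ℕ.≤-trans (subst (λ c → suc c ≤ length (leftOf (suc c))) c≡ (leftOf-parking i)) (ℕ.≤-reflexive total)))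

  path-labels : labels (path f) ↭ allFin n
  path-labels = subst (λ xs → xs ++ labels (path f) ↭ allFin n) leftOf-0 (runs-labels id (λ _ → refl) refl)
    where
    leftOf-0 : leftOf 0 ≡ []
    leftOf-0 with leftOf 0 in eq
    ... | []     = refl
    ... | x ∷ xs with () ← proj₂ (∈-filter⁻ (left? 0) {xs = allFin n} (subst (x ∈_) (sym eq) (here refl)))

  path-dyck : Dyck 0 0 (path f)
  path-dyck = runs-dyck id (λ _ → refl) refl (sym (count-none (left? 0) (allFin n) λ _ ()))

  path-unique : Unique (labels (path f))
  path-unique = Permutationₛ.Unique-resp-↭ (setoid (Fin n)) (↭⇒↭ₛ (↭-sym path-labels)) (Unique.allFin⁺ n)

  path-labelled : IsLabelledDyck n (path f)
  path-labelled = dyck⇒labelled path-dyck path-unique (trans (↭-length path-labels) (length-allFin n))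

  path-∋ : ∀ ℓ → ℓ ∈ labels (path f)
  path-∋ ℓ = ∈-resp-↭ (↭-sym path-labels) (∈-allFin ℓ)

  path-column : ∀ ℓ → column (path f) ℓ ≡ suc (toℕ (f ⟨ ℓ ⟩))
  path-column ℓ with ∈-labels⁻ (path f) (path-∋ ℓ)
  ... | A , B , eq = begin
    column (path f) ℓ          ≡⟨ cong (λ P → column P ℓ) eq ⟩
    column (A ++ N ℓ ∷ B) ℓ    ≡⟨ column-split A (subst (Unique ∘ labels) eq path-unique) ⟩
    suc (#E A)                 ≡⟨
      cong suc (columns-split A (subst (Columns f 0) eq (runs-columns id (λ _ → refl)))) ⟨
    suc (toℕ (f ⟨ ℓ ⟩))        ∎
    where open ≡-Reasoning

-- The map φ

-- Turns a count over a prefix of the reading word into one over the whole word, which may then be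
-- permuted into the labels of the path.
preceding-count : ∀ {Pre Q : Fin n → Set} {_≲_ : Fin n → Fin n → Set} {ℓ}
  (pre? : Decidable Pre) (Q? : Decidable Q) →
  (∀ {y} → y ≲ ℓ → y ≢ ℓ → Pre y) → (∀ {y} → y ≡ ℓ ⊎ ℓ ≲ y → ¬ Pre y) →
  ∀ w → AllPairs _≲_ w → ℓ ∈ w →
  count Q? (preceding w ℓ) ≡ count (λ y → pre? y ×-dec Q? y) w
preceding-count {ℓ = ℓ} pre? Q? lower upper (y ∷ w) (y≲ ∷ sorted) ℓ∈ with y Fin.≟ ℓ
... | yes refl = sym (count-none (λ y → pre? y ×-dec Q? y) (y ∷ w) none)
  where
  none : ∀ {z} → z ∈ y ∷ w → ¬ (_ × _)
  none (here refl) (pre , _) = upper (inj₁ refl) pre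
  none (there z∈)  (pre , _) = upper (inj₂ (All.lookup y≲ z∈)) pre
preceding-count {ℓ = ℓ} pre? Q? lower upper (y ∷ w) (y≲ ∷ sorted) (here refl) | no y≢ℓ = contradiction refl y≢ℓ
preceding-count {ℓ = ℓ} pre? Q? lower upper (y ∷ w) (y≲ ∷ sorted) (there ℓ∈) | no y≢ℓ
  with pre? y | Q? y | preceding-count pre? Q? lower upper w sorted ℓ∈
... | yes _  | yes _ | ih = cong suc ih
... | yes _  | no  _ | ih = ih
... | no ¬pre | _    | _  = contradiction (lower (All.lookup y≲ ℓ∈) y≢ℓ) ¬pre

-- Serves to exclude ties in the reading order: equal area and equal column give equal rows.
row-injective : ∀ {m} {P : Path n} → IsLabelledDyck m P → ∀ {μ ℓ} → μ ∈ labels P → ℓ ∈ labels P →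
                row P μ ≡ row P ℓ → μ ≡ ℓ
row-injective {P = P} D {μ} {ℓ} μ∈ ℓ∈ row≡ with ∈-labels⁻ P ℓ∈
... | A , B , P≡ with ∈-map⁻ proj₂ (subst (μ ∈_) (sym (labels-word 0 P)) μ∈)
...   | z , z∈ , refl
  with ∈-++⁻ (word 0 A) (subst (z ∈_) (trans (cong (word 0) P≡) (word-++ 0 A (N ℓ ∷ B))) z∈)
...     | inj₁ z∈A         = contradiction (proj₂ (proj₂ (earlier-located D A P≡ z∈A))) (ℕ.<-irrefl row≡)
...     | inj₂ (here refl) = refl
...     | inj₂ (there z∈B) = contradiction (proj₂ (proj₂ (later-located D A P≡ z∈B))) (ℕ.<-irrefl (sym row≡))

-- Subtracting `d` from the number of preceding letters leaves those that form no inversion with ℓ.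
φ-encodes : (f : PF n) → Encodes (φ f) (path f)
φ-encodes {n} f {A} {ℓ} {B} P≡ = begin
  toℕ (φ f ⟨ ℓ ⟩)                                      ≡⟨ toℕ-φ-values f ℓ ⟩
  φ-value f ℓ
    ≡⟨ length-∸-count (λ μ → dinv? P μ ℓ) (preceding (dinvWord f) ℓ) ⟩
  count (λ μ → ¬? (dinv? P μ ℓ)) (preceding (dinvWord f) ℓ)
    ≡⟨ preceding-count (λ μ → precedes? P μ ℓ) (λ μ → ¬? (dinv? P μ ℓ)) lower upper (dinvWord f) sorted
         (∈-resp-↭ (↭-sym (dinvWord-↭ f)) (∈-allFin ℓ)) ⟩
  count (reading? path-D A P≡) (dinvWord f)            ≡⟨ count-↭ (reading? path-D A P≡) (dinvWord-↭ f) ⟩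
  count (reading? path-D A P≡) (allFin n)              ≡⟨ count-↭ (reading? path-D A P≡) (path-labels f) ⟨
  count (reading? path-D A P≡) (labels P)              ≡⟨ value-reading path-D A P≡ ⟩
  value A ℓ B                                          ∎
  where
  open ≡-Reasoning
  P = path f
  path-D = path-labelled f
  open DecTotalOrder (readingOrder f) using () renaming (_≤_ to _≲_; trans to ≲-trans)

  sorted : AllPairs _≲_ (dinvWord f)
  sorted = Linked.Linked⇒AllPairs (λ {x} {y} {z} → ≲-trans {x} {y} {z})
    (InsertionSort.sort-↗ (readingOrder f) (allFin n))

  column-< : ∀ {μ ν} → f ⟨ μ ⟩ Fin.< f ⟨ ν ⟩ → column P μ < column P ν
  column-< {μ} {ν} lt = subst₂ _<_ (sym (path-column f μ)) (sym (path-column f ν)) (s≤s lt)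

  located′ : ∀ μ → column P μ + area P μ ≡ row P μ
  located′ μ with ∈-labels⁻ P (path-∋ f μ)
  ... | A , B , P≡ = proj₁ (proj₂ (located path-D A P≡))

  lower : ∀ {y} → y ≲ ℓ → y ≢ ℓ → Precedes P y ℓ
  lower (inj₁ (a≤ , a≢)) _ = inj₁ (ℕ.≤∧≢⇒< a≤ a≢)
  lower {y} (inj₂ (a≡ , f≤)) y≢ℓ with ℕ.m≤n⇒m<n∨m≡n f≤
  ... | inj₁ f< = inj₂ (a≡ , column-< f<)
  ... | inj₂ f≡ = contradiction (row-injective path-D (path-∋ f y) (path-∋ f ℓ)
    (trans (sym (located′ y)) (trans (cong₂ _+_ column≡ a≡) (located′ ℓ)))) y≢ℓ
    where
    column≡ : column P y ≡ column P ℓ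
    column≡ = trans (path-column f y) (trans (cong suc f≡) (sym (path-column f ℓ)))

  upper : ∀ {y} → y ≡ ℓ ⊎ ℓ ≲ y → ¬ Precedes P y ℓ
  upper (inj₁ refl) (inj₁ a<)       = ℕ.n≮n _ a<
  upper (inj₁ refl) (inj₂ (_ , c<)) = ℕ.n≮n _ c<
  upper (inj₂ (inj₁ (a≤ , _)))  (inj₁ a<)        = ℕ.<⇒≱ a< a≤
  upper (inj₂ (inj₁ (_ , a≢)))  (inj₂ (a≡ , _))  = a≢ (sym a≡)
  upper (inj₂ (inj₂ (a≡ , _)))  (inj₁ a<)        = ℕ.<-irrefl (sym a≡) a<
  upper {y} (inj₂ (inj₂ (_ , f≤))) (inj₂ (_ , c<)) =
    ℕ.<⇒≱ c< (subst₂ _≤_ (sym (path-column f ℓ)) (sym (path-column f y)) (s≤s f≤))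

-- The insertion procedure applied to φ f

κ-order : ∀ n → DecTotalOrder _ _ _
κ-order n = On.decTotalOrder ℕ.≤-decTotalOrder (κ {n})

builds-φ : (f : PF n) → Builds (φ f) (pmajWord (φ f)) (path f)
builds-φ {n} f = subst (λ w → Builds (φ f) w P) (sym pmaj≡)
  (proj₁ (builds (length S) S refl (path-dyck f) S↭ sorted unique enc))
  where
  P = path f
  enc : Encodes (φ f) P
  enc = φ-encodes f
  S : List (ℕ × Fin n)
  S = InsertionSort.sort (κ-order n) (word 0 P)
  S↭ : S ↭ word 0 P
  S↭ = InsertionSort.sort-↭ (κ-order n) (word 0 P)

  labels-S : map proj₂ S ↭ labels P
  labels-S = labels-↭ P S↭

  unique : Unique (map proj₂ S)
  unique = Permutationₛ.Unique-resp-↭ (setoid (Fin n)) (↭⇒↭ₛ (↭-sym labels-S)) (path-unique f)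

  sorted : AllPairs (λ z x → κ z < κ x) S
  sorted = AllPairs.map
    (λ { {z} {x} (le , ℓ≢) → ℕ.≤∧≢⇒< le (λ eq → ℓ≢ (cong proj₂ (κ-injective {x = z} {x} eq))) })
    (AllPairs.zip (Linked.Linked⇒AllPairs ℕ.≤-trans (InsertionSort.sort-↗ (κ-order n) (word 0 P))
                  , AllPairs.map⁻ unique))

  atMost : ∀ {x} → x ∈ S → toℕ (φ f ⟨ proj₂ x ⟩) ≤ count (lower? x) S
  atMost {x@(_ , ℓ)} x∈ with ∈-word⁻ 0 P (∈-resp-↭ S↭ x∈)
  ... | A , B , P≡ , refl = begin
    toℕ (φ f ⟨ ℓ ⟩)                             ≡⟨ enc P≡ ⟩
    value A ℓ B                                 ≤⟨ value-≤ A ℓ B ⟩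
    count (lower? x) (word 0 (A ++ N ℓ ∷ B))    ≡⟨ cong (count (lower? x) ∘ word 0) P≡ ⟨
    count (lower? x) (word 0 P)                 ≡⟨ count-↭ (lower? x) S↭ ⟨
    count (lower? x) S                          ∎
    where open ℕ.≤-Reasoning

  atLeast : ∀ {x} → x ∈ S → 1 ≤ proj₁ x → count (farLower? x) S < toℕ (φ f ⟨ proj₂ x ⟩)
  atLeast {x@(_ , ℓ)} x∈ 1≤a with ∈-word⁻ 0 P (∈-resp-↭ S↭ x∈)
  ... | A , B , P≡ , refl = begin-strict
    count (farLower? x) S                         ≡⟨ count-↭ (farLower? x) S↭ ⟩
    count (farLower? x) (word 0 P)                ≡⟨ cong (count (farLower? x) ∘ word 0) P≡ ⟩
    count (farLower? x) (word 0 (A ++ N ℓ ∷ B))   <⟨ value-> A ℓ B (subst (Dyck 0 0) P≡ (path-dyck f)) 1≤a ⟩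
    value A ℓ B                                   ≡⟨ enc P≡ ⟨
    toℕ (φ f ⟨ ℓ ⟩)                               ∎
    where open ℕ.≤-Reasoning

  length-S : n ≡ length S
  length-S = begin
    n                       ≡⟨ length-allFin n ⟨
    length (allFin n)       ≡⟨ ↭-length (path-labels f) ⟨
    length (labels P)       ≡⟨ ↭-length labels-S ⟨
    length (map proj₂ S)    ≡⟨ length-map proj₂ S ⟩
    length S                ∎
    where open ≡-Reasoning

  pmaj≡ : pmajWord (φ f) ≡ map proj₂ S
  pmaj≡ = pmajWord-sorted (φ f) S sorted unique
    (λ b → ∈-resp-↭ (↭-sym labels-S) (path-∋ f b)) atMost atLeast length-S

-- Bijectivity of φ

-- The equation of the words is an argument of its own because indices of the form `σs ∷ʳ ℓ` do not
-- unify directly.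
builds-unique : ∀ {g : PF n} {σs τs P Q} → Builds g σs P → Builds g τs Q → σs ≡ τs → P ≡ Q
builds-unique start start _ = refl
builds-unique start (extend {σs} _ _) eq = contradiction (sym eq) (∷ʳ≢[] σs)
builds-unique (extend {σs} _ _) start eq = contradiction eq (∷ʳ≢[] σs)
builds-unique (extend {σs} {ℓ = ℓ} b (_ , _ , !)) (extend {τs} b′ (_ , point , _)) eq
  with refl , refl ← ∷ʳ-injective σs τs eq
  with refl ← builds-unique b b′ refl
  with refl ← ! point = refl

PF-≡ : {f g : PF n} → (∀ ℓ → f ⟨ ℓ ⟩ ≡ g ⟨ ℓ ⟩) → f ≡ g
PF-≡ {f = mkPF v _} {mkPF w _} eq
  with refl ← trans (sym (tabulate∘lookup v)) (trans (tabulate-cong eq) (tabulate∘lookup w)) = refl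

path-injective : {f g : PF n} → path f ≡ path g → f ≡ g
path-injective {f = f} {g} eq = PF-≡ λ ℓ → Fin.toℕ-injective (ℕ.suc-injective
  (trans (sym (path-column f ℓ)) (trans (cong (λ P → column P ℓ) eq) (path-column g ℓ))))

φ-injective : Injective _≡_ _≡_ (φ {n})
φ-injective {x = f} {g} eq = path-injective (builds-unique (builds-φ f)
  (subst (λ h → Builds h (pmajWord h) (path g)) (sym eq) (builds-φ g)) refl)

-- Two iterates of x coincide by the pigeonhole principle; cancelling h, so
-- does x with one of its proper iterates.
finite-surjective : ∀ {m} {code : X → Fin m} {h : X → X} →
                    Injective _≡_ _≡_ code → Injective _≡_ _≡_ h → ∀ x → ∃ λ y → h y ≡ x
finite-surjective {m = m} {code} {h} code-inj h-inj x
  with Fin.pigeonhole (ℕ.n<1+n m) (λ i → code (fold x h (toℕ i)))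
... | i , j , i<j , eq = cancel (toℕ i) (toℕ j) i<j (code-inj eq)
  where
  cancel : ∀ i j → i < j → fold x h i ≡ fold x h j → ∃ λ y → h y ≡ x
  cancel zero    (suc j) _         eq = fold x h j , sym eq
  cancel (suc i) (suc j) (s≤s i<j) eq = cancel i j i<j (h-inj eq)

code : PF n → Fin (n ^ n)
code f = Fin.funToFin (f ⟨_⟩)

code-injective : Injective _≡_ _≡_ (code {n})
code-injective {n} {f} {g} eq = PF-≡ λ ℓ →
  trans (sym (Fin.finToFun-funToFin {n} {n} (f ⟨_⟩) ℓ))
    (trans (cong (λ c → Fin.finToFun {n} {n} c ℓ) eq) (Fin.finToFun-funToFin {n} {n} (g ⟨_⟩) ℓ))

-- `builds-φ` at ψ g describes the procedure for φ (ψ g), which is g; injectivity of φ makes the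
-- section a two-sided inverse.
section-of-φ : (ψ : PF n → PF n) → (∀ g → φ (ψ g) ≡ g) → IsPsi ψ × Inverseᵇ _≡_ _≡_ φ ψ
section-of-φ ψ φψ =
  (λ g → subst (λ h → Builds h (pmajWord h) (path (ψ g))) (φψ g) (builds-φ (ψ g))) ,
  (λ { {x} refl → φψ x }) , (λ { {x} refl → φ-injective (φψ (φ x)) })

φ-surjective : ∀ g → ∃ λ f → φ {n} f ≡ g
φ-surjective = finite-surjective {code = code} {h = φ}
  (λ {f} {g} → code-injective {_} {f} {g}) (λ {f} {g} → φ-injective {_} {f} {g})

theorem6p2 : (n : ℕ) → 1 ≤ n →
    Σ[ ψ ∈ (PF n → PF n) ] (IsPsi ψ × Inverseᵇ _≡_ _≡_ (φ {n}) ψ)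
theorem6p2 n _ = proj₁ ∘ φ-surjective , section-of-φ (proj₁ ∘ φ-surjective) (proj₂ ∘ φ-surjective)
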